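{- Let $a,b,c$ be nonzero integers, not all of the same sign, and let $E$ denote the equation $ax+by+cz=0$. Then $E$ is uncommon over $[n]$, i.e. \[\limsup_{n\to\infty}\mu_E([n]) < \frac14 .\]
   Context: For $n\in\mathbb{N}$, $[n]=\{1,2,\dots,n\}$. For an equation $E: a_1x_1+\cdots+a_kx_k=0$ with integer coefficients and a finite set $A$ on which the equation makes sense (here $A=[n]$), let $T_E(A)=\{(x_1,\dots,x_k)\in A^k : a_1x_1+\cdots+a_kx_k=0\}$. A coloring is a function $f:A\to\{ -1,1\}$; the set of monochromatic solutions is $M_E(f)=\{(x_1,\dots,x_k)\in T_E(A): f(x_1)=\cdots=f(x_k)\}$, and $\mu_E(f)=|M_E(f)|/|T_E(A)|$. Finally $\mu_E(A)=\min_{f:A\to\{ -1,1\}}\mu_E(f)$. An equation in $k$ variables is called uncommon over $[n]$ if $\limsup_{n\to\infty}\mu_E([n])<2^{1-k}$ (here $k=3$, so the threshold is $1/4$, the expected monochromatic proportion under a uniformly random coloring). -}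

module Defs where

open import Data.Nat using (ℕ; suc)
open import Data.Integer using (ℤ; +_; _+_; _*_; 0ℤ)
import Data.Integer as ℤ
open import Data.Fin using (Fin; toℕ)
open import Data.List using (List; filter; length; allFin; map; concatMap)
open import Data.Bool using (Bool)
import Data.Bool as B
open import Data.Product using (_×_; _,_)
open import Relation.Nullary using (Dec)
open import Relation.Nullary.Decidable using (_×-dec_)
open import Relation.Binary.PropositionalEquality using (_≡_)

-- Convention: the element i : Fin n represents the integer i+1, so Fin n ≅ [n] = {1,…,n}.
val : ∀ {n} → Fin n → ℤ
val i = + suc (toℕ i)

-- A coloring of [n] with two colours ({-1,1} represented by Bool).
Coloring : ℕ → Set
Coloring n = Fin n → Bool

Triple : ℕ → Set
Triple n = Fin n × Fin n × Fin n

triples : (n : ℕ) → List (Triple n)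
triples n = concatMap (λ x → concatMap (λ y → map (λ z → x , y , z) (allFin n)) (allFin n)) (allFin n)

IsSol : ℤ → ℤ → ℤ → ∀ {n} → Triple n → Set
IsSol a b c (x , y , z) = a * val x + b * val y + c * val z ≡ 0ℤ

isSol? : (a b c : ℤ) → ∀ {n} → (t : Triple n) → Dec (IsSol a b c t)
isSol? a b c (x , y , z) = (a * val x + b * val y + c * val z) ℤ.≟ 0ℤ

Mono : ∀ {n} → Coloring n → Triple n → Set
Mono f (x , y , z) = (f x ≡ f y) × (f y ≡ f z)

mono? : ∀ {n} → (f : Coloring n) → (t : Triple n) → Dec (Mono f t)
mono? f (x , y , z) = (f x B.≟ f y) ×-dec (f y B.≟ f z)

solCount : (a b c : ℤ) (n : ℕ) → ℕ
solCount a b c n = length (filter (isSol? a b c) (triples n))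

monoCount : (a b c : ℤ) (n : ℕ) → Coloring n → ℕ
monoCount a b c n f = length (filter (λ t → isSol? a b c t ×-dec mono? f t) (triples n))

{-# OPTIONS --safe #-}
module Submission where

-- For a ±1-colouring f, four times the number of monochromatic solutions is the number of solutions plus the
-- correlation sum E(f) of f(x)f(y) + f(y)f(z) + f(x)f(z) over all solutions, so it suffices to make E(f) ≤ -εn².
-- E is a quadratic form with diagonal entries at most 3. Hence a partial colouring g : [n] → {-1,0,1} can be
-- completed one element at a time by the better sign, by E(g+e) + E(g-e) = 2E(g) + 2E(e), losing only O(n).
--
-- Write the equation as αx + βy = γz with α, β, γ > 0. Take g = 1 on blocks P⁺, Q⁺ and -1 on blocks P⁻, Q⁻, all of
-- length proportional to n and inside one residue class modulo a multiple of αβγ. On such elements the number of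
-- solutions with two prescribed variables is constant, apart from the thresholds αx < γz and βy < γz (if
-- everything is small compared with n), and constants cancel within P⁺ ∪ P⁻ and within Q⁺ ∪ Q⁻. If α ≠ γ, put the
-- P's near γs and the Q's near αs so that αx < γz holds for exactly one of the four sign pairs x ∈ P±, z ∈ Q±,
-- namely (P⁺, Q⁻). This contributes -h² for blocks of h elements. The other threshold contributes nothing positive,
-- except possibly if γ² = αβ, and then the residue class is chosen to make it void. If α = β = γ, the equation is
-- x + y = z, and the constraint x + y ≤ n plays the role of the threshold.

open import Defs
open import Algebra using (AbelianGroup)
import Algebra.Properties.Group
import Algebra.Properties.Semiring.Sum
open import Data.Bool using (Bool; true; false; if_then_else_)
open import Data.Empty using (⊥-elim)
open import Data.Fin using (Fin; zero; suc; toℕ; fromℕ<)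
open import Data.Fin.Patterns
import Data.Fin.Properties as Fin
open import Data.Integer using (ℤ; 0ℤ)
import Data.Integer as ℤ
import Data.Integer.Divisibility.Signed
import Data.Integer.Properties
open import Data.Integer.Tactic.RingSolver using (solve-∀)
open import Data.List using (List; []; _∷_; filter; length; concatMap; map; tabulate; allFin; _++_)
open import Data.List.Membership.Propositional using (_∈_)
open import Data.List.Membership.Propositional.Properties using (∈-allFin)
open import Data.List.Properties using (filter-++; length-++; length-tabulate)
open import Data.List.Relation.Unary.Any using (here; there)
open import Data.Nat using (ℕ; zero; suc; z≤n; s≤s; NonZero)
import Data.Nat as ℕ
import Data.Nat.Coprimality as Coprimality
import Data.Nat.Divisibility as ℕD
import Data.Nat.DivMod as ℕ
open import Data.Nat.GCD using (gcd; gcd[m,n]∣m; gcd[m,n]∣n; gcd[m,n]≢0)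
import Data.Nat.Properties as ℕP
import Data.Nat.Tactic.RingSolver as ℕSolver
open import Data.Product using (Σ; _×_; _,_; proj₁; proj₂)
open import Data.Sum using (_⊎_; inj₁; inj₂)
open import Function using (_∘_; id)
open import Relation.Binary.Definitions using (tri<; tri≈; tri>)
open import Relation.Binary.PropositionalEquality
open import Relation.Nullary using (Dec; yes; no; ¬_; does)
open import Relation.Nullary.Decidable using (_×-dec_; _→-dec_; from-yes)
open import Relation.Unary using (Decidable)

module Correlation where

  open Data.Integer hiding (suc; _⊔_; _⊓_; NonZero; pos)
  open Data.Integer.Divisibility.Signed
  open Data.Integer.Properties hiding (_≟_)
  open Algebra.Properties.Group (AbelianGroup.group +-0-abelianGroup) using ()
    renaming (∙-cancelˡ to +-cancelˡ; ∙-cancelʳ to +-cancelʳ)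
  open Algebra.Properties.Semiring.Sum +-*-semiring
    using (sum; sum-syntax; sum-cong-≗; ∑-distrib-+; ∑-comm; *-distribˡ-sum; sum-replicate-zero)

  -- Finite sums and quadratic forms

  𝟙 : ∀ {p} {P : Set p} → Dec P → ℤ
  𝟙 d = if does d then 1ℤ else 0ℤ

  module _ {p} {P : Set p} where

    𝟙-yes : (d : Dec P) → P → 𝟙 d ≡ 1ℤ
    𝟙-yes (yes _) _ = refl
    𝟙-yes (no ¬p) p = ⊥-elim (¬p p)

    𝟙-no : (d : Dec P) → ¬ P → 𝟙 d ≡ 0ℤ
    𝟙-no (yes p) ¬p = ⊥-elim (¬p p)
    𝟙-no (no _) _ = refl

    𝟙≤1 : (d : Dec P) → 𝟙 d ≤ 1ℤ
    𝟙≤1 (yes _) = ≤-refl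
    𝟙≤1 (no _) = +≤+ ℕ.z≤n

  𝟙-⇔ : ∀ {p q} {P : Set p} {Q : Set q} (d : Dec P) (e : Dec Q) →
        (P → Q) → (Q → P) → 𝟙 d ≡ 𝟙 e
  𝟙-⇔ (yes p) e f g = sym (𝟙-yes e (f p))
  𝟙-⇔ (no ¬p) e f g = sym (𝟙-no e (¬p ∘ g))

  +-congˡ : ∀ c {x y} → x ≡ y → c + x ≡ c + y
  +-congˡ c refl = refl

  sum-mono : ∀ {n} {f g : Fin n → ℤ} → (∀ i → f i ≤ g i) → sum f ≤ sum g
  sum-mono {zero} h = ≤-refl
  sum-mono {suc n} h = +-mono-≤ (h zero) (sum-mono (h ∘ suc))

  sum-zero : ∀ {n} {f : Fin n → ℤ} → (∀ i → f i ≡ 0ℤ) → sum f ≡ 0ℤ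
  sum-zero {n} h = trans (sum-cong-≗ h) (sum-replicate-zero n)

  sum-const : ∀ n c → sum {n} (λ _ → c) ≡ + n * c
  sum-const zero c = refl
  sum-const (suc n) c = trans (+-congˡ c (sum-const n c)) (sym (suc-* (+ n) c))

  sum-single : ∀ {n} {f : Fin n → ℤ} k → (∀ i → i ≢ k → f i ≡ 0ℤ) → sum f ≡ f k
  sum-single {suc n} {f} zero h =
    trans (+-congˡ (f zero) (sum-zero (λ i → h (suc i) λ ()))) (+-identityʳ _)
  sum-single {suc n} {f} (suc k) h =
    trans (cong₂ _+_ (h zero λ ()) (sum-single k (λ i i≢k → h (suc i) (i≢k ∘ Fin.suc-injective))))
          (+-identityˡ _)

  sum-sift : ∀ {n} (u : Fin n) (F : Fin n → ℤ) → sum (λ x → 𝟙 (u Fin.≟ x) * F x) ≡ F u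
  sum-sift u F = begin
    sum (λ x → 𝟙 (u Fin.≟ x) * F x)
      ≡⟨ sum-single u (λ i i≢u → cong (_* F i) (𝟙-no (u Fin.≟ i) (i≢u ∘ sym))) ⟩
    𝟙 (u Fin.≟ u) * F u             ≡⟨ cong (_* F u) (𝟙-yes (u Fin.≟ u) refl) ⟩
    1ℤ * F u                        ≡⟨ *-identityˡ (F u) ⟩
    F u                             ∎
    where open ≡-Reasoning

  module _ {n} {P : Fin n → Set} (P? : ∀ i → Dec (P i)) where

    sum-𝟙-none : (∀ i → ¬ P i) → sum (λ i → 𝟙 (P? i)) ≡ 0ℤ
    sum-𝟙-none h = sum-zero (λ i → 𝟙-no (P? i) (h i))

    module _ (unique : ∀ {i j} → P i → P j → i ≡ j) where

      sum-𝟙-unique : ∀ {k} → P k → sum (λ i → 𝟙 (P? i)) ≡ 1ℤ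
      sum-𝟙-unique {k} pk = trans
        (sum-single k (λ i i≢k → 𝟙-no (P? i) (λ pi → i≢k (unique pi pk))))
        (𝟙-yes (P? k) pk)

      sum-𝟙≤1 : sum (λ i → 𝟙 (P? i)) ≤ 1ℤ
      sum-𝟙≤1 with Fin.any? P?
      ... | yes (k , pk) = ≤-reflexive (sum-𝟙-unique pk)
      ... | no ∄ = ≤-trans (≤-reflexive (sum-𝟙-none (λ i pi → ∄ (i , pi)))) (+≤+ ℕ.z≤n)

  module _ {A : Set} {P : A → Set} (P? : Decidable P) where

    count : List A → ℤ
    count xs = + length (filter P? xs)

    count-++ : ∀ xs ys → count (xs ++ ys) ≡ count xs + count ys
    count-++ xs ys = trans
      (cong (λ l → + length l) (filter-++ P? xs ys))
      (cong +_ (length-++ (filter P? xs)))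

    count-concatMap-tabulate : ∀ {B : Set} (F : B → List A) {n} (t : Fin n → B) →
      count (concatMap F (tabulate t)) ≡ sum (λ i → count (F (t i)))
    count-concatMap-tabulate F {zero} t = refl
    count-concatMap-tabulate F {suc n} t = trans
      (count-++ (F (t zero)) _)
      (+-congˡ (count (F (t zero))) (count-concatMap-tabulate F (t ∘ suc)))

    count-map-tabulate : ∀ {B : Set} (F : B → A) {n} (t : Fin n → B) →
      count (map F (tabulate t)) ≡ sum (λ i → 𝟙 (P? (F (t i))))
    count-map-tabulate F {zero} t = refl
    count-map-tabulate F {suc n} t with P? (F (t zero))
    ... | yes _ = +-congˡ 1ℤ (count-map-tabulate F (t ∘ suc))
    ... | no _ = trans (count-map-tabulate F (t ∘ suc)) (sym (+-identityˡ _))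

  ∑³ : ∀ {n} → (Fin n → Fin n → Fin n → ℤ) → ℤ
  ∑³ {n} F = ∑[ x < n ] ∑[ y < n ] ∑[ z < n ] F x y z

  ∑³-cong : ∀ {n} {F G : Fin n → Fin n → Fin n → ℤ} → (∀ x y z → F x y z ≡ G x y z) → ∑³ F ≡ ∑³ G
  ∑³-cong h = sum-cong-≗ λ x → sum-cong-≗ λ y → sum-cong-≗ (h x y)

  ∑³-+ : ∀ {n} (F G : Fin n → Fin n → Fin n → ℤ) → ∑³ (λ x y z → F x y z + G x y z) ≡ ∑³ F + ∑³ G
  ∑³-+ F G = trans
    (sum-cong-≗ λ x → trans (sum-cong-≗ λ y → ∑-distrib-+ (F x y) (G x y))
                            (∑-distrib-+ (λ y → sum (F x y)) (λ y → sum (G x y))))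
    (∑-distrib-+ (λ x → sum λ y → sum (F x y)) (λ x → sum λ y → sum (G x y)))

  ∑³-swap₁₂ : ∀ {n} (F : Fin n → Fin n → Fin n → ℤ) → ∑³ F ≡ ∑³ (λ x y z → F y x z)
  ∑³-swap₁₂ F = ∑-comm (λ x y → sum (F x y))

  ∑³-swap₂₃ : ∀ {n} (F : Fin n → Fin n → Fin n → ℤ) → ∑³ F ≡ ∑³ (λ x y z → F x z y)
  ∑³-swap₂₃ F = sum-cong-≗ λ x → ∑-comm (F x)

  *-sum : ∀ {n} c (F : Fin n → ℤ) → sum (λ i → c * F i) ≡ c * sum F
  *-sum c F = sym (*-distribˡ-sum c F)

  -- On signs this is 3 if all three agree and -1 otherwise, so 1 + `pairs` is four times the
  -- indicator of a monochromatic triple.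
  pairs : ℤ → ℤ → ℤ → ℤ
  pairs u v w = u * v + v * w + u * w

  module QuadraticForm {n} (ω : Fin n → Fin n → Fin n → ℤ) where

    E : (Fin n → ℤ) → ℤ
    E g = ∑³ λ x y z → ω x y z * pairs (g x) (g y) (g z)

    -- When `ω` is the indicator of solutions, each N counts the solutions with two prescribed
    -- variables, named by its indices. `W` is a matrix of the quadratic form `E`; it need not be
    -- symmetric.
    N₁₂ N₁₃ N₂₃ W : Fin n → Fin n → ℤ
    N₁₂ x y = ∑[ z < n ] ω x y z
    N₁₃ x z = ∑[ y < n ] ω x y z
    N₂₃ y z = ∑[ x < n ] ω x y z
    W u v = N₁₂ u v + N₂₃ u v + N₁₃ u v

    E-cong : ∀ {g g′} → (∀ x → g x ≡ g′ x) → E g ≡ E g′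
    E-cong h = ∑³-cong λ x y z → cong (ω x y z *_)
      (cong₂ _+_ (cong₂ _+_ (cong₂ _*_ (h x) (h y)) (cong₂ _*_ (h y) (h z))) (cong₂ _*_ (h x) (h z)))

    bilinear : (Fin n → ℤ) → (Fin n → Fin n → ℤ) → ℤ
    bilinear g K = ∑[ u < n ] ∑[ v < n ] (g u * g v * K u v)

    bilinear-+ : ∀ g K L → bilinear g (λ u v → K u v + L u v) ≡ bilinear g K + bilinear g L
    bilinear-+ g K L = trans
      (sum-cong-≗ λ u → trans
        (sum-cong-≗ λ v → *-distribˡ-+ (g u * g v) (K u v) (L u v))
        (∑-distrib-+ (λ v → g u * g v * K u v) (λ v → g u * g v * L u v)))
      (∑-distrib-+ (λ u → sum λ v → g u * g v * K u v) (λ u → sum λ v → g u * g v * L u v))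

    -- Each product in `pairs` leaves one variable free; summing over that variable first produces
    -- the corresponding count.
    E≡bilinear : ∀ g → E g ≡ bilinear g W
    E≡bilinear g = begin
      E g
        ≡⟨ ∑³-cong (λ x y z → expand (ω x y z) (g x) (g y) (g z)) ⟩
      ∑³ (λ x y z → A x y z + B x y z + C x y z)
        ≡⟨ ∑³-+ (λ x y z → A x y z + B x y z) C ⟩
      ∑³ (λ x y z → A x y z + B x y z) + ∑³ C
        ≡⟨ cong (_+ ∑³ C) (∑³-+ A B) ⟩
      ∑³ A + ∑³ B + ∑³ C
        ≡⟨ cong₂ _+_ (cong₂ _+_ eqA eqB) eqC ⟩
      bilinear g N₁₂ + bilinear g N₂₃ + bilinear g N₁₃
        ≡⟨ cong (_+ bilinear g N₁₃) (bilinear-+ g N₁₂ N₂₃) ⟨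
      bilinear g (λ u v → N₁₂ u v + N₂₃ u v) + bilinear g N₁₃
        ≡⟨ bilinear-+ g (λ u v → N₁₂ u v + N₂₃ u v) N₁₃ ⟨
      bilinear g W ∎
      where
      open ≡-Reasoning
      A B C : Fin n → Fin n → Fin n → ℤ
      A x y z = g x * g y * ω x y z
      B x y z = g y * g z * ω x y z
      C x y z = g x * g z * ω x y z
      expand : ∀ s u v w → s * (u * v + v * w + u * w) ≡ u * v * s + v * w * s + u * w * s
      expand = solve-∀
      eqA : ∑³ A ≡ bilinear g N₁₂
      eqA = sum-cong-≗ λ x → sum-cong-≗ λ y → *-sum (g x * g y) (ω x y)
      eqC : ∑³ C ≡ bilinear g N₁₃
      eqC = trans (∑³-swap₂₃ C)
        (sum-cong-≗ λ x → sum-cong-≗ λ z → *-sum (g x * g z) (λ y → ω x y z))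
      eqB : ∑³ B ≡ bilinear g N₂₃
      eqB = trans (∑³-swap₁₂ B) (trans (∑³-swap₂₃ (λ y x z → B x y z))
        (sum-cong-≗ λ y → sum-cong-≗ λ z → *-sum (g y * g z) (λ x → ω x y z)))

    δ : Fin n → Fin n → ℤ
    δ i x = 𝟙 (i Fin.≟ x)

    E-δ : ∀ i → E (δ i) ≡ W i i
    E-δ i = begin
      E (δ i) ≡⟨ E≡bilinear (δ i) ⟩
      bilinear (δ i) W
        ≡⟨ (sum-cong-≗ λ u → trans (sum-cong-≗ λ v → *-assoc (δ i u) (δ i v) (W u v)) (*-sum (δ i u) (λ v → δ i v * W u v))) ⟩
      ∑[ u < n ] (δ i u * ∑[ v < n ] (δ i v * W u v)) ≡⟨ sum-sift i (λ u → ∑[ v < n ] (δ i v * W u v)) ⟩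
      ∑[ v < n ] (δ i v * W i v) ≡⟨ sum-sift i (W i) ⟩
      W i i ∎
      where open ≡-Reasoning

    -- The law holds triple by triple, since `pairs` is a quadratic form. With e = `δ i` it bounds
    -- the increase caused by the better of the two signs at i by the diagonal entry `W i i`.
    parallelogram : ∀ g e → E (λ x → g x + e x) + E (λ x → g x - e x) ≡ E g + E g + (E e + E e)
    parallelogram g e = begin
      E (λ x → g x + e x) + E (λ x → g x - e x)
        ≡⟨ ∑³-+ (T (λ x → g x + e x)) (T (λ x → g x - e x)) ⟨
      ∑³ (λ x y z → ω x y z * pairs (g x + e x) (g y + e y) (g z + e z) + ω x y z * pairs (g x - e x) (g y - e y) (g z - e z))
        ≡⟨ ∑³-cong (λ x y z → identity (ω x y z) (g x) (g y) (g z) (e x) (e y) (e z)) ⟩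
      ∑³ (λ x y z → (T g x y z + T g x y z) + (T e x y z + T e x y z))
        ≡⟨ ∑³-+ (λ x y z → T g x y z + T g x y z) (λ x y z → T e x y z + T e x y z) ⟩
      ∑³ (λ x y z → T g x y z + T g x y z) + ∑³ (λ x y z → T e x y z + T e x y z)
        ≡⟨ cong₂ _+_ (∑³-+ (T g) (T g)) (∑³-+ (T e) (T e)) ⟩
      E g + E g + (E e + E e) ∎
      where
      open ≡-Reasoning
      T : (Fin n → ℤ) → Fin n → Fin n → Fin n → ℤ
      T g x y z = ω x y z * pairs (g x) (g y) (g z)
      identity : ∀ s u v w a b c →
        s * ((u + a) * (v + b) + (v + b) * (w + c) + (u + a) * (w + c))
          + s * ((u - a) * (v - b) + (v - b) * (w - c) + (u - a) * (w - c))
        ≡ (s * (u * v + v * w + u * w) + s * (u * v + v * w + u * w))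
          + (s * (a * b + b * c + a * c) + s * (a * b + b * c + a * c))
      identity = solve-∀

  -- Completing a partial colouring

  Trit : ℤ → Set
  Trit i = (i ≡ 0ℤ) ⊎ (i ≡ 1ℤ) ⊎ (i ≡ -1ℤ)

  Sign : ℤ → Set
  Sign i = (i ≡ 1ℤ) ⊎ (i ≡ -1ℤ)

  either-≤ : ∀ {a b} s → a + b ≡ s + s → (a ≤ s) ⊎ (b ≤ s)
  either-≤ {a} {b} s eq with a ≤? s | b ≤? s
  ... | yes a≤s | _ = inj₁ a≤s
  ... | no _ | yes b≤s = inj₂ b≤s
  ... | no a≰s | no b≰s = ⊥-elim (<⇒≢ (+-mono-< (≰⇒> a≰s) (≰⇒> b≰s)) (sym eq))

  module Fill {n} (ω : Fin n → Fin n → Fin n → ℤ) where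
    open QuadraticForm ω

    module _ (W≤3 : ∀ i → W i i ≤ + 3) where

      FilledAt : (Fin n → ℤ) → Fin n → Set
      FilledAt g i = Σ (Fin n → ℤ) λ g′ →
        (∀ x → Trit (g′ x)) × Sign (g′ i) × (∀ x → Sign (g x) → Sign (g′ x)) × (E g′ ≤ E g + + 3)

      -- At an uncoloured i the values of `E` at g + `δ i` and g - `δ i` have mean `E g + W i i`, so
      -- one of the two is at most `E g + + 3`.
      fill-one : ∀ g → (∀ x → Trit (g x)) → ∀ i → FilledAt g i
      fill-one g tr i with tr i
      ... | inj₂ si = g , tr , si , (λ _ s → s) ,
        ≤-trans (≤-reflexive (sym (+-identityʳ (E g)))) (+-monoʳ-≤ (E g) (+≤+ ℕ.z≤n))
      ... | inj₁ gi≡0 = pick (either-≤ (E g + E (δ i)) (trans (parallelogram g (δ i)) (regroup (E g) (E (δ i)))))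
        where
        regroup : ∀ a b → a + a + (b + b) ≡ a + b + (a + b)
        regroup = solve-∀
        bound : E g + E (δ i) ≤ E g + + 3
        bound = +-monoʳ-≤ (E g) (≤-trans (≤-reflexive (E-δ i)) (W≤3 i))
        at-i : ∀ {s} → Sign s → Sign (g i + s * δ i i)
        at-i {s} h = subst Sign (sym (begin
          g i + s * δ i i ≡⟨ cong₂ (λ a b → a + s * b) gi≡0 (𝟙-yes (i Fin.≟ i) refl) ⟩
          0ℤ + s * 1ℤ     ≡⟨ trans (+-identityˡ _) (*-identityʳ s) ⟩
          s               ∎)) h
          where open ≡-Reasoning
        off-i : ∀ s {x} → x ≢ i → g x + s * δ i x ≡ g x
        off-i s {x} x≢i = begin
          g x + s * δ i x ≡⟨ cong (λ b → g x + s * b) (𝟙-no (i Fin.≟ x) (x≢i ∘ sym)) ⟩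
          g x + s * 0ℤ    ≡⟨ +-congˡ (g x) (*-zeroʳ s) ⟩
          g x + 0ℤ        ≡⟨ +-identityʳ (g x) ⟩
          g x             ∎
          where open ≡-Reasoning
        all-trit : ∀ {s} → Sign s → ∀ x → Trit (g x + s * δ i x)
        all-trit {s} h x with x Fin.≟ i
        ... | yes refl = inj₂ (at-i h)
        ... | no x≢i = subst Trit (sym (off-i s x≢i)) (tr x)
        keep : ∀ {s} → Sign s → ∀ x → Sign (g x) → Sign (g x + s * δ i x)
        keep {s} h x sx with x Fin.≟ i
        ... | yes refl = at-i h
        ... | no x≢i = subst Sign (sym (off-i s x≢i)) sx
        choose : ∀ {s g′} → Sign s → (∀ x → g′ x ≡ g x + s * δ i x) → E g′ ≤ E g + E (δ i) → FilledAt g i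
        choose {s} {g′} h eq le =
          (λ x → g x + s * δ i x) , all-trit h , at-i h , keep h ,
          ≤-trans (≤-reflexive (sym (E-cong {g′} eq))) (≤-trans le bound)
        pick : (E (λ x → g x + δ i x) ≤ E g + E (δ i)) ⊎ (E (λ x → g x - δ i x) ≤ E g + E (δ i)) → FilledAt g i
        pick (inj₁ le) = choose (inj₁ refl) (λ x → +-congˡ (g x) (sym (*-identityˡ (δ i x)))) le
        pick (inj₂ le) = choose (inj₂ refl) (λ x → +-congˡ (g x) (sym (-1*i≡-i (δ i x)))) le

      fill-list : ∀ g → (∀ x → Trit (g x)) → (xs : List (Fin n)) → Σ (Fin n → ℤ) λ g′ →
        (∀ x → Trit (g′ x)) × (∀ x → (Sign (g x)) ⊎ (x ∈ xs) → Sign (g′ x)) × (E g′ ≤ E g + + 3 * + length xs)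
      fill-list g tr [] = g , tr , (λ { x (inj₁ s) → s }) , ≤-reflexive (sym (+-identityʳ (E g)))
      fill-list g tr (i ∷ xs) =
        let g₁ , tr₁ , s₁ , k₁ , le₁ = fill-one g tr i
            g₂ , tr₂ , s₂ , le₂ = fill-list g₁ tr₁ xs
        in g₂ , tr₂
         , (λ { x (inj₁ s) → s₂ x (inj₁ (k₁ x s))
              ; x (inj₂ (here refl)) → s₂ x (inj₁ s₁)
              ; x (inj₂ (there x∈xs)) → s₂ x (inj₂ x∈xs) })
         , ≤-trans le₂ (≤-trans (+-monoˡ-≤ (+ 3 * + length xs) le₁)
             (≤-reflexive (assemble (E g) (+ length xs))))
        where
        assemble : ∀ e l → e + + 3 + + 3 * l ≡ e + + 3 * (1ℤ + l)
        assemble = solve-∀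

      fill : ∀ g → (∀ x → Trit (g x)) → Σ (Fin n → ℤ) λ f →
        (∀ x → Sign (f x)) × (E f ≤ E g + + 3 * + n)
      fill g tr =
        let f , _ , s , le = fill-list g tr (allFin n)
        in f , (λ x → s x (inj₂ (∈-allFin x)))
         , subst (λ l → E f ≤ E g + + 3 * + l) (length-tabulate {n = n} id) le

  -- From correlations to monochromatic solutions

  ω : (a b c : ℤ) → ∀ {n} → Fin n → Fin n → Fin n → ℤ
  ω a b c x y z = 𝟙 (isSol? a b c (x , y , z))

  val-injective : ∀ {n} {i j : Fin n} → val i ≡ val j → i ≡ j
  val-injective eq = Fin.toℕ-injective (ℕP.suc-injective (+-injective eq))

  coefficient-cancel : ∀ k {n} {i j : Fin n} → k ≢ 0ℤ → k * val i ≡ k * val j → i ≡ j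
  coefficient-cancel k {i = i} {j} k≢0 eq = val-injective (*-cancelˡ-≡ k (val i) (val j) ⦃ ≢-nonZero k≢0 ⦄ eq)

  module _ (a b c : ℤ) {n : ℕ} where

    open QuadraticForm (ω a b c {n})

    unique₃ : c ≢ 0ℤ → ∀ (x y : Fin n) {z z′} → IsSol a b c (x , y , z) → IsSol a b c (x , y , z′) → z ≡ z′
    unique₃ c≢0 x y {z} {z′} p q = coefficient-cancel c c≢0
      (+-cancelˡ (a * val x + b * val y) (c * val z) (c * val z′) (trans p (sym q)))

    unique₂ : b ≢ 0ℤ → ∀ (x z : Fin n) {y y′} → IsSol a b c (x , y , z) → IsSol a b c (x , y′ , z) → y ≡ y′
    unique₂ b≢0 x z {y} {y′} p q = coefficient-cancel b b≢0
      (+-cancelˡ (a * val x) (b * val y) (b * val y′)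
        (+-cancelʳ (c * val z) (a * val x + b * val y) (a * val x + b * val y′) (trans p (sym q))))

    unique₁ : a ≢ 0ℤ → ∀ (y z : Fin n) {x x′} → IsSol a b c (x , y , z) → IsSol a b c (x′ , y , z) → x ≡ x′
    unique₁ a≢0 y z {x} {x′} p q = coefficient-cancel a a≢0
      (+-cancelʳ (b * val y) (a * val x) (a * val x′)
        (+-cancelʳ (c * val z) (a * val x + b * val y) (a * val x′ + b * val y) (trans p (sym q))))

    module _ (a≢0 : a ≢ 0ℤ) (b≢0 : b ≢ 0ℤ) (c≢0 : c ≢ 0ℤ) where

      N₁₂≤1 : ∀ x y → N₁₂ x y ≤ 1ℤ
      N₁₂≤1 x y = sum-𝟙≤1 (λ z → isSol? a b c (x , y , z)) (λ {z} {z′} → unique₃ c≢0 x y {z} {z′})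

      -- The coefficients are nonzero, so any two coordinates of a solution determine the third, and
      -- each of the three counts is at most 1.
      W≤3 : ∀ i → W i i ≤ + 3
      W≤3 i = +-mono-≤ (+-mono-≤ (N₁₂≤1 i i)
        (sum-𝟙≤1 (λ x → isSol? a b c (x , i , i)) (λ {x} {x′} → unique₁ a≢0 i i {x} {x′})))
        (sum-𝟙≤1 (λ y → isSol? a b c (i , y , i)) (λ {y} {y′} → unique₂ b≢0 i i {y} {y′}))

  count-triples : ∀ n {P : Triple n → Set} (P? : Decidable P) →
    count P? (triples n) ≡ ∑³ (λ x y z → 𝟙 (P? (x , y , z)))
  count-triples n P? = trans
    (count-concatMap-tabulate P? (λ x → concatMap (λ y → map (λ z → x , y , z) (allFin n)) (allFin n)) {n} id)
    (sum-cong-≗ {n} λ x → trans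
      (count-concatMap-tabulate P? (λ y → map (λ z → x , y , z) (allFin n)) {n} id)
      (sum-cong-≗ {n} λ y → count-map-tabulate P? (λ z → x , y , z) {n} id))

  σ : Bool → ℤ
  σ true = 1ℤ
  σ false = -1ℤ

  Sign⇒σ : ∀ {i} → Sign i → Σ Bool λ b → i ≡ σ b
  Sign⇒σ (inj₁ eq) = true , eq
  Sign⇒σ (inj₂ eq) = false , eq

  -- Both sides vanish off the solution set; on it the eight colour patterns are checked.
  mono-weight : ∀ a b c {n} (f : Coloring n) x y z →
    + 4 * 𝟙 (isSol? a b c (x , y , z) ×-dec mono? f (x , y , z))
      ≡ ω a b c x y z + ω a b c x y z * pairs (σ (f x)) (σ (f y)) (σ (f z))
  mono-weight a b c f x y z with isSol? a b c (x , y , z) | f x | f y | f z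
  ... | no _ | _ | _ | _ = refl
  ... | yes _ | true | true | true = refl
  ... | yes _ | true | true | false = refl
  ... | yes _ | true | false | true = refl
  ... | yes _ | true | false | false = refl
  ... | yes _ | false | true | true = refl
  ... | yes _ | false | true | false = refl
  ... | yes _ | false | false | true = refl
  ... | yes _ | false | false | false = refl

  module _ (a b c : ℤ) (n : ℕ) where
    open QuadraticForm (ω a b c {n})

    solCount≡∑³ : + solCount a b c n ≡ ∑³ (ω a b c {n})
    solCount≡∑³ = count-triples n (isSol? a b c)

    4*monoCount : ∀ f → + 4 * + monoCount a b c n f ≡ + solCount a b c n + E (σ ∘ f)
    4*monoCount f = begin
      + 4 * + monoCount a b c n f ≡⟨ cong (+ 4 *_) (count-triples n (λ t → isSol? a b c t ×-dec mono? f t)) ⟩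
      + 4 * ∑³ M                  ≡⟨ push ⟨
      ∑³ (λ x y z → + 4 * M x y z) ≡⟨ ∑³-cong (mono-weight a b c f) ⟩
      ∑³ (λ x y z → ω a b c x y z + T x y z) ≡⟨ ∑³-+ (ω a b c {n}) T ⟩
      ∑³ (ω a b c {n}) + E (σ ∘ f) ≡⟨ cong (_+ E (σ ∘ f)) (sym solCount≡∑³) ⟩
      + solCount a b c n + E (σ ∘ f) ∎
      where
      open ≡-Reasoning
      M T : Fin n → Fin n → Fin n → ℤ
      M x y z = 𝟙 (isSol? a b c (x , y , z) ×-dec mono? f (x , y , z))
      T x y z = ω a b c x y z * pairs (σ (f x)) (σ (f y)) (σ (f z))
      push : ∑³ (λ x y z → + 4 * M x y z) ≡ + 4 * ∑³ M
      push = trans (sum-cong-≗ λ x → trans (sum-cong-≗ λ y → *-sum (+ 4) (M x y))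
        (*-sum (+ 4) (λ y → sum (M x y)))) (*-sum (+ 4) (λ x → sum λ y → sum (M x y)))

    solCount≤n² : a ≢ 0ℤ → b ≢ 0ℤ → c ≢ 0ℤ → solCount a b c n ℕ.≤ n ℕ.* n
    solCount≤n² a≢0 b≢0 c≢0 = drop‿+≤+ (begin
      + solCount a b c n ≡⟨ solCount≡∑³ ⟩
      ∑³ (ω a b c {n}) ≤⟨ sum-mono {n} (λ x → sum-mono {n} (λ y → N₁₂≤1 a b c a≢0 b≢0 c≢0 x y)) ⟩
      ∑[ x < n ] ∑[ y < n ] 1ℤ ≡⟨ sum-cong-≗ {n} (λ _ → sum-const n 1ℤ) ⟩
      ∑[ x < n ] (+ n * 1ℤ) ≡⟨ sum-const n (+ n * 1ℤ) ⟩
      + n * (+ n * 1ℤ) ≡⟨ cong (+ n *_) (*-identityʳ (+ n)) ⟩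
      + n * + n ≡⟨ pos-* n n ⟨
      + (n ℕ.* n) ∎)
      where open ≤-Reasoning

  -- The hypotheses say that h = ⌊n / (m + 1)⌋ and that h is large; g = 0 marks the uncoloured elements.
  NegativelyCorrelated : ℤ → ℤ → ℤ → Set
  NegativelyCorrelated a b c = Σ ℕ λ m → (n h : ℕ) →
    suc m ℕ.* h ℕ.≤ n → n ℕ.< suc m ℕ.* suc h → suc m ℕ.≤ h →
    Σ (Fin n → ℤ) λ g → (∀ x → Trit (g x)) × (QuadraticForm.E (ω a b c) g ≤ - (+ h * + h))

  -- Here p/q = r/(4(r + 1)) with r + 1 = 8m². For n ≥ 12m² one has h ≥ 12m and n ≤ 2mh, so
  -- completing the partial colouring costs 3n ≤ h²/2 and the number S of solutions is at most n² ≤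
  -- 4m²h². Hence E ≤ -h²/2 ≤ -S/(8m²), and four times the monochromatic count is at most S(1 -
  -- 1/(8m²)).
  uncommon : ∀ a b c → a ≢ 0ℤ → b ≢ 0ℤ → c ≢ 0ℤ → NegativelyCorrelated a b c →
    Σ ℕ (λ p → Σ ℕ (λ q → (4 ℕ.* p ℕ.< q) × Σ ℕ (λ N → (n : ℕ) → N ℕ.≤ n →
    Σ (Coloring n) (λ f → q ℕ.* monoCount a b c n f ℕ.≤ p ℕ.* solCount a b c n))))
  uncommon a b c a≢0 b≢0 c≢0 (k , partial) =
    r , 4 ℕ.* suc r , ℕP.*-monoʳ-< 4 (ℕP.n<1+n r) , 12 ℕ.* m ℕ.* m , coloring
    where
    m r : ℕ
    m = suc k
    -- As m is a successor, `suc r` reduces to 8m² by computation.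
    r = ℕ.pred (8 ℕ.* (m ℕ.* m))
    module _ (n : ℕ) (N≤n : 12 ℕ.* m ℕ.* m ℕ.≤ n) where
      open QuadraticForm (ω a b c {n})
      h : ℕ
      h = n ℕ./ m
      12m≤h : 12 ℕ.* m ℕ.≤ h
      12m≤h = subst (ℕ._≤ h) (ℕ.m*n/n≡m (12 ℕ.* m) m) (ℕ./-monoˡ-≤ m N≤n)
      m≤h : m ℕ.≤ h
      m≤h = ℕP.≤-trans (ℕP.m≤m+n m _) 12m≤h
      n<m[1+h] : n ℕ.< m ℕ.* suc h
      n<m[1+h] = begin-strict
        n ≡⟨ ℕ.m≡m%n+[m/n]*n n m ⟩
        n ℕ.% m ℕ.+ h ℕ.* m <⟨ ℕP.+-monoˡ-< (h ℕ.* m) (ℕ.m%n<n n m) ⟩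
        m ℕ.+ h ℕ.* m ≡⟨ ℕP.*-comm (suc h) m ⟩
        m ℕ.* suc h ∎
        where open ℕP.≤-Reasoning
      n≤2mh : n ℕ.≤ 2 ℕ.* (m ℕ.* h)
      n≤2mh = begin
        n ≤⟨ ℕP.<⇒≤ n<m[1+h] ⟩
        m ℕ.* suc h ≤⟨ ℕP.*-monoʳ-≤ m (ℕP.+-monoˡ-≤ h (ℕP.≤-trans (s≤s z≤n) m≤h)) ⟩
        m ℕ.* (h ℕ.+ h) ≡⟨ e m h ⟩
        2 ℕ.* (m ℕ.* h) ∎
        where
        open ℕP.≤-Reasoning
        e : ∀ m h → m ℕ.* (h ℕ.+ h) ≡ 2 ℕ.* (m ℕ.* h)
        e = ℕSolver.solve-∀
      6n≤h² : 6 ℕ.* n ℕ.≤ h ℕ.* h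
      6n≤h² = begin
        6 ℕ.* n ≤⟨ ℕP.*-monoʳ-≤ 6 n≤2mh ⟩
        6 ℕ.* (2 ℕ.* (m ℕ.* h)) ≡⟨ e m h ⟩
        12 ℕ.* m ℕ.* h ≤⟨ ℕP.*-monoˡ-≤ h 12m≤h ⟩
        h ℕ.* h ∎
        where
        open ℕP.≤-Reasoning
        e : ∀ m h → 6 ℕ.* (2 ℕ.* (m ℕ.* h)) ≡ 12 ℕ.* m ℕ.* h
        e = ℕSolver.solve-∀
      n²≤4m²h² : n ℕ.* n ℕ.≤ 4 ℕ.* (m ℕ.* m) ℕ.* (h ℕ.* h)
      n²≤4m²h² = ℕP.≤-trans (ℕP.*-mono-≤ n≤2mh n≤2mh) (ℕP.≤-reflexive (e m h))
        where
        e : ∀ m h → 2 ℕ.* (m ℕ.* h) ℕ.* (2 ℕ.* (m ℕ.* h)) ≡ 4 ℕ.* (m ℕ.* m) ℕ.* (h ℕ.* h)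
        e = ℕSolver.solve-∀
      coloring : Σ (Coloring n) (λ f → 4 ℕ.* suc r ℕ.* monoCount a b c n f ℕ.≤ r ℕ.* solCount a b c n)
      coloring with partial n h (ℕP.≤-trans (ℕP.≤-reflexive (ℕP.*-comm m h)) (ℕ.m/n*n≤m n m)) n<m[1+h] m≤h
      ... | g , trit , Eg≤ with Fill.fill (ω a b c) (W≤3 a b c a≢0 b≢0 c≢0) g trit
      ... | s , sign , Es≤ = f , drop‿+≤+ final
        where
        f : Coloring n
        f x = proj₁ (Sign⇒σ (sign x))
        S M : ℕ
        S = solCount a b c n
        M = monoCount a b c n f
        Ef≤ : E (σ ∘ f) ≤ - (+ h * + h) + + 3 * + n
        Ef≤ = begin
          E (σ ∘ f) ≡⟨ E-cong (λ x → proj₂ (Sign⇒σ (sign x))) ⟨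
          E s ≤⟨ Es≤ ⟩
          E g + + 3 * + n ≤⟨ +-monoˡ-≤ (+ 3 * + n) Eg≤ ⟩
          - (+ h * + h) + + 3 * + n ∎
          where open ≤-Reasoning
        2Ef≤ : + 2 * E (σ ∘ f) ≤ - (+ (h ℕ.* h))
        2Ef≤ = begin
          + 2 * E (σ ∘ f) ≤⟨ *-monoˡ-≤-nonNeg (+ 2) Ef≤ ⟩
          + 2 * (- (+ h * + h) + + 3 * + n) ≡⟨ e (+ h) (+ n) ⟩
          + 6 * + n - + 2 * (+ h * + h) ≡⟨ cong₂ (λ u v → u - + 2 * v) (sym (pos-* 6 n)) (sym (pos-* h h)) ⟩
          + (6 ℕ.* n) - + 2 * + (h ℕ.* h) ≤⟨ +-monoˡ-≤ (- (+ 2 * + (h ℕ.* h))) (+≤+ 6n≤h²) ⟩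
          + (h ℕ.* h) - + 2 * + (h ℕ.* h) ≡⟨ e′ (+ (h ℕ.* h)) ⟩
          - (+ (h ℕ.* h)) ∎
          where
          open ≤-Reasoning
          e : ∀ h n → + 2 * (- (h * h) + + 3 * n) ≡ + 6 * n - + 2 * (h * h)
          e = solve-∀
          e′ : ∀ x → x - + 2 * x ≡ - x
          e′ = solve-∀
        R*Ef≤ : + (8 ℕ.* (m ℕ.* m)) * E (σ ∘ f) ≤ - (+ S)
        R*Ef≤ = begin
          + (8 ℕ.* (m ℕ.* m)) * E (σ ∘ f)
            ≡⟨ cong (_* E (σ ∘ f)) (trans (pos-* 8 (m ℕ.* m)) (cong (+ 8 *_) (pos-* m m))) ⟩
          + 8 * (+ m * + m) * E (σ ∘ f) ≡⟨ e (+ m) (E (σ ∘ f)) ⟩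
          + 4 * (+ m * + m) * (+ 2 * E (σ ∘ f))
            ≡⟨ cong (_* (+ 2 * E (σ ∘ f))) (sym (trans (pos-* 4 (m ℕ.* m)) (cong (+ 4 *_) (pos-* m m)))) ⟩
          + (4 ℕ.* (m ℕ.* m)) * (+ 2 * E (σ ∘ f)) ≤⟨ *-monoˡ-≤-nonNeg (+ (4 ℕ.* (m ℕ.* m))) 2Ef≤ ⟩
          + (4 ℕ.* (m ℕ.* m)) * - (+ (h ℕ.* h)) ≡⟨ neg-distribʳ-* (+ (4 ℕ.* (m ℕ.* m))) (+ (h ℕ.* h)) ⟨
          - (+ (4 ℕ.* (m ℕ.* m)) * + (h ℕ.* h)) ≡⟨ cong -_ (pos-* (4 ℕ.* (m ℕ.* m)) (h ℕ.* h)) ⟨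
          - (+ (4 ℕ.* (m ℕ.* m) ℕ.* (h ℕ.* h)))
            ≤⟨ neg-mono-≤ (+≤+ (ℕP.≤-trans (solCount≤n² a b c n a≢0 b≢0 c≢0) n²≤4m²h²)) ⟩
          - (+ S) ∎
          where
          open ≤-Reasoning
          e : ∀ m x → + 8 * (m * m) * x ≡ + 4 * (m * m) * (+ 2 * x)
          e = solve-∀
        final : + (4 ℕ.* suc r ℕ.* M) ≤ + (r ℕ.* S)
        final = begin
          + (4 ℕ.* suc r ℕ.* M) ≡⟨ trans (pos-* (4 ℕ.* suc r) M) (cong (_* + M) (pos-* 4 (suc r))) ⟩
          + 4 * + suc r * + M ≡⟨ e (+ suc r) (+ M) ⟩
          + suc r * (+ 4 * + M) ≡⟨ cong (+ suc r *_) (4*monoCount a b c n f) ⟩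
          + suc r * (+ S + E (σ ∘ f)) ≡⟨ *-distribˡ-+ (+ suc r) (+ S) (E (σ ∘ f)) ⟩
          + suc r * + S + + suc r * E (σ ∘ f) ≤⟨ +-monoʳ-≤ (+ suc r * + S) R*Ef≤ ⟩
          + suc r * + S - + S ≡⟨ e′ (+ r) (+ S) ⟩
          + r * + S ≡⟨ pos-* r S ⟨
          + (r ℕ.* S) ∎
          where
          open ≤-Reasoning
          e : ∀ r x → + 4 * r * x ≡ r * (+ 4 * x)
          e = solve-∀
          e′ : ∀ r s → (1ℤ + r) * s - s ≡ r * s
          e′ = solve-∀

  -- Symmetries of the equation

  -- `pairs` is symmetric, so renaming the summation variables permutes the coefficients and leaves
  -- the value at g unchanged.
  E-swap₁₂ : ∀ a b c {n} (g : Fin n → ℤ) → QuadraticForm.E (ω a b c) g ≡ QuadraticForm.E (ω b a c) g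
  E-swap₁₂ a b c g = trans (∑³-swap₁₂ (λ x y z → ω a b c x y z * pairs (g x) (g y) (g z)))
    (∑³-cong λ x y z → cong₂ _*_
      (𝟙-⇔ (isSol? a b c (y , x , z)) (isSol? b a c (x , y , z))
        (trans (cong (_+ c * val z) (+-comm (b * val x) (a * val y))))
        (trans (cong (_+ c * val z) (+-comm (a * val y) (b * val x)))))
      (pairs-sym (g y) (g x) (g z)))
    where
    pairs-sym : ∀ u v w → u * v + v * w + u * w ≡ v * u + u * w + v * w
    pairs-sym = solve-∀

  E-swap₂₃ : ∀ a b c {n} (g : Fin n → ℤ) → QuadraticForm.E (ω a b c) g ≡ QuadraticForm.E (ω a c b) g
  E-swap₂₃ a b c g = trans (∑³-swap₂₃ (λ x y z → ω a b c x y z * pairs (g x) (g y) (g z)))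
    (∑³-cong λ x y z → cong₂ _*_
      (𝟙-⇔ (isSol? a b c (x , z , y)) (isSol? a c b (x , y , z))
        (trans (sum-sym (a * val x) (c * val y) (b * val z)))
        (trans (sum-sym (a * val x) (b * val z) (c * val y))))
      (pairs-sym (g x) (g z) (g y)))
    where
    sum-sym : ∀ u v w → u + v + w ≡ u + w + v
    sum-sym = solve-∀
    pairs-sym : ∀ u v w → u * v + v * w + u * w ≡ u * w + w * v + u * v
    pairs-sym = solve-∀

  E-neg : ∀ a b c {n} (g : Fin n → ℤ) → QuadraticForm.E (ω a b c) g ≡ QuadraticForm.E (ω (- a) (- b) (- c)) g
  E-neg a b c g = ∑³-cong λ x y z → cong (_* pairs (g x) (g y) (g z))
    (𝟙-⇔ (isSol? a b c (x , y , z)) (isSol? (- a) (- b) (- c) (x , y , z))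
      (λ eq → trans (negated a b c (val x) (val y) (val z)) (cong -_ eq))
      (λ eq → neg-injective (trans (sym (negated a b c (val x) (val y) (val z))) eq)))
    where
    negated : ∀ a b c x y z → (- a) * x + (- b) * y + (- c) * z ≡ - (a * x + b * y + c * z)
    negated = solve-∀

  module _ {a b c a′ b′ c′}
    (E-eq : ∀ {n} (g : Fin n → ℤ) → QuadraticForm.E (ω a b c) g ≡ QuadraticForm.E (ω a′ b′ c′) g) where

    transfer : NegativelyCorrelated a′ b′ c′ → NegativelyCorrelated a b c
    transfer (m , partial) = m , λ n h p q r →
      let g , tr , le = partial n h p q r in g , tr , ≤-trans (≤-reflexive (E-eq g)) le

  swap₁₂ : ∀ {a b c} → NegativelyCorrelated b a c → NegativelyCorrelated a b c
  swap₁₂ {a} {b} {c} = transfer {a} {b} {c} {b} {a} {c} (E-swap₁₂ a b c)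

  swap₂₃ : ∀ {a b c} → NegativelyCorrelated a c b → NegativelyCorrelated a b c
  swap₂₃ {a} {b} {c} = transfer {a} {b} {c} {a} {c} {b} (E-swap₂₃ a b c)

  negate : ∀ {a b c} → NegativelyCorrelated (- a) (- b) (- c) → NegativelyCorrelated a b c
  negate {a} {b} {c} = transfer {a} {b} {c} {(- a)} {(- b)} {(- c)} (E-neg a b c)

  -- Dipoles and mixed second differences

  Δ : ∀ {n} → (Fin n → Fin n → ℤ) → Fin n → Fin n → Fin n → Fin n → ℤ
  Δ K x x′ y y′ = K x y - K x y′ - K x′ y + K x′ y′

  x+x≤0⇒x≤0 : ∀ {x} → x + x ≤ 0ℤ → x ≤ 0ℤ
  x+x≤0⇒x≤0 {+ zero} _ = ≤-refl
  x+x≤0⇒x≤0 { -[1+ n ]} _ = -≤+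
  x+x≤0⇒x≤0 {+[1+ n ]} (+≤+ ())

  -- Transposing one of two copies of the sum pairs F s t with F t s. This serves comparisons inside
  -- a single block, where only the symmetrised term has a known sign.
  ∑∑-antisymmetric : ∀ {h} (F : Fin h → Fin h → ℤ) → (∀ s t → F s t + F t s ≤ 0ℤ) →
    ∑[ s < h ] ∑[ t < h ] F s t ≤ 0ℤ
  ∑∑-antisymmetric {h} F F+Fᵀ≤0 = x+x≤0⇒x≤0 (begin
    ∑F + ∑F                                    ≡⟨ +-congˡ ∑F (∑-comm F) ⟩
    ∑F + ∑[ s < h ] ∑[ t < h ] F t s           ≡⟨ ∑-distrib-+ (λ s → sum (F s)) (λ s → sum (λ t → F t s)) ⟨
    ∑[ s < h ] (sum (F s) + sum (λ t → F t s)) ≡⟨ (sum-cong-≗ λ s → ∑-distrib-+ (F s) (λ t → F t s)) ⟨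
    ∑[ s < h ] ∑[ t < h ] (F s t + F t s)      ≤⟨ (sum-mono λ s → sum-mono λ t → F+Fᵀ≤0 s t) ⟩
    ∑[ s < h ] ∑[ t < h ] 0ℤ                   ≡⟨ (sum-zero λ (_ : Fin h) → sum-zero {h} λ _ → refl) ⟩
    0ℤ ∎)
    where
    open ≤-Reasoning
    ∑F : ℤ
    ∑F = ∑[ s < h ] ∑[ t < h ] F s t

  module Dipoles {n h} (pos : Fin 4 → Fin h → Fin n)
    (pos-injective : ∀ i j s t → pos i s ≡ pos j t → i ≡ j × s ≡ t) where

    -- The indices 0F, 1F, 2F, 3F stand for the blocks P⁺, P⁻, Q⁺, Q⁻.
    sgn : Fin 4 → ℤ
    sgn 0F = 1ℤ
    sgn 1F = -1ℤ
    sgn 2F = 1ℤ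
    sgn 3F = -1ℤ

    dipoles : Fin n → ℤ
    dipoles u = ∑[ t < h ] ∑[ i < 4 ] (sgn i * 𝟙 (pos i t Fin.≟ u))

    dipoles-trit : ∀ u → Trit (dipoles u)
    dipoles-trit u with Fin.any? (λ t → Fin.any? (λ i → pos i t Fin.≟ u))
    ... | no ∄ = inj₁ (sum-zero λ t → sum-zero λ i →
            trans (cong (sgn i *_) (𝟙-no (pos i t Fin.≟ u) (λ eq → ∄ (t , i , eq)))) (*-zeroʳ (sgn i)))
    ... | yes (t₀ , i₀ , refl) = subst Trit (sym total) (sgn-trit i₀)
      where
      sgn-trit : ∀ i → Trit (sgn i)
      sgn-trit 0F = inj₂ (inj₁ refl)
      sgn-trit 1F = inj₂ (inj₂ refl)
      sgn-trit 2F = inj₂ (inj₁ refl)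
      sgn-trit 3F = inj₂ (inj₂ refl)
      miss : ∀ i t → ¬ (i ≡ i₀ × t ≡ t₀) → sgn i * 𝟙 (pos i t Fin.≟ pos i₀ t₀) ≡ 0ℤ
      miss i t ne = trans
        (cong (sgn i *_) (𝟙-no (pos i t Fin.≟ pos i₀ t₀) (ne ∘ pos-injective i i₀ t t₀)))
        (*-zeroʳ (sgn i))
      total : dipoles (pos i₀ t₀) ≡ sgn i₀
      total = trans (sum-single t₀ λ t t≢ → sum-zero λ i → miss i t (t≢ ∘ proj₂))
        (trans (sum-single i₀ λ i i≢ → miss i t₀ (i≢ ∘ proj₁))
        (trans (cong (sgn i₀ *_) (𝟙-yes (pos i₀ t₀ Fin.≟ pos i₀ t₀) refl)) (*-identityʳ (sgn i₀))))

    ∑-dipoles : ∀ F → ∑[ u < n ] (dipoles u * F u) ≡ ∑[ t < h ] ∑[ i < 4 ] (sgn i * F (pos i t))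
    ∑-dipoles F = begin
      ∑[ u < n ] (dipoles u * F u)
        ≡⟨ sum-cong-≗ {n} (λ u → trans (*-comm (dipoles u) (F u)) (trans
            (*-distribˡ-sum (F u) (λ t → ∑[ i < 4 ] (sgn i * d u i t)))
            (sum-cong-≗ λ t → *-distribˡ-sum (F u) (λ i → sgn i * d u i t)))) ⟩
      ∑[ u < n ] ∑[ t < h ] ∑[ i < 4 ] (F u * (sgn i * d u i t))
        ≡⟨ ∑-comm (λ u t → ∑[ i < 4 ] (F u * (sgn i * d u i t))) ⟩
      ∑[ t < h ] ∑[ u < n ] ∑[ i < 4 ] (F u * (sgn i * d u i t))
        ≡⟨ sum-cong-≗ {h} (λ t → ∑-comm (λ u i → F u * (sgn i * d u i t))) ⟩
      ∑[ t < h ] ∑[ i < 4 ] ∑[ u < n ] (F u * (sgn i * d u i t))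
        ≡⟨ sum-cong-≗ {h} (λ t → sum-cong-≗ {4} λ i → trans
            (sum-cong-≗ λ u → reorder (F u) (sgn i) (d u i t))
            (trans (*-sum (sgn i) (λ u → d u i t * F u)) (cong (sgn i *_) (sum-sift (pos i t) F)))) ⟩
      ∑[ t < h ] ∑[ i < 4 ] (sgn i * F (pos i t)) ∎
      where
      open ≡-Reasoning
      d : Fin n → Fin 4 → Fin h → ℤ
      d u i t = 𝟙 (pos i t Fin.≟ u)
      reorder : ∀ f s e → f * (s * e) ≡ s * (e * f)
      reorder = solve-∀

    module _ (K : Fin n → Fin n → ℤ) where

      Δpp Δpq Δqp Δqq : Fin h → Fin h → ℤ
      Δpp s t = Δ K (pos 0F s) (pos 1F s) (pos 0F t) (pos 1F t)
      Δpq s t = Δ K (pos 0F s) (pos 1F s) (pos 2F t) (pos 3F t)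
      Δqp s t = Δ K (pos 2F s) (pos 3F s) (pos 0F t) (pos 1F t)
      Δqq s t = Δ K (pos 2F s) (pos 3F s) (pos 2F t) (pos 3F t)

      -- The t-th elements of P⁺ and P⁻ form a dipole of charges 1 and -1, and so do those of Q⁺ and
      -- Q⁻. The interaction of two dipoles under K is the mixed difference `Δ K`, and for fixed s
      -- and t the sixteen signed values group into four of these.
      ∑∑-dipoles : ∑[ u < n ] ∑[ v < n ] (dipoles u * dipoles v * K u v)
                 ≡ ∑[ s < h ] ∑[ t < h ] (Δpp s t + Δqq s t + (Δpq s t + Δqp s t))
      ∑∑-dipoles = begin
        ∑[ u < n ] ∑[ v < n ] (dipoles u * dipoles v * K u v)
          ≡⟨ (sum-cong-≗ {n} λ u → trans (sum-cong-≗ {n} λ v → *-assoc (dipoles u) (dipoles v) (K u v))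
               (*-sum (dipoles u) (λ v → dipoles v * K u v))) ⟩
        ∑[ u < n ] (dipoles u * ∑[ v < n ] (dipoles v * K u v))
          ≡⟨ (sum-cong-≗ {n} λ u → cong (dipoles u *_) (∑-dipoles (K u))) ⟩
        ∑[ u < n ] (dipoles u * ∑[ t < h ] R u t)
          ≡⟨ ∑-dipoles (λ u → ∑[ t < h ] R u t) ⟩
        ∑[ s < h ] ∑[ i < 4 ] (sgn i * ∑[ t < h ] R (pos i s) t)
          ≡⟨ (sum-cong-≗ {h} λ s → trans
               (sum-cong-≗ {4} λ i → *-distribˡ-sum (sgn i) (R (pos i s)))
               (∑-comm (λ i t → sgn i * R (pos i s) t))) ⟩
        ∑[ s < h ] ∑[ t < h ] ∑[ i < 4 ] (sgn i * R (pos i s) t)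
          ≡⟨ (sum-cong-≗ {h} λ s → sum-cong-≗ {h} λ t → expand s t) ⟩
        ∑[ s < h ] ∑[ t < h ] (Δpp s t + Δqq s t + (Δpq s t + Δqp s t)) ∎
        where
        open ≡-Reasoning
        R : Fin n → Fin h → ℤ
        R u t = ∑[ j < 4 ] (sgn j * K u (pos j t))
        alternate : ∀ a b c d → 1ℤ * a + (-1ℤ * b + (1ℤ * c + (-1ℤ * d + 0ℤ))) ≡ a - b + (c - d)
        alternate = solve-∀
        identity : ∀ a b c d a′ b′ c′ d′ e f g h e′ f′ g′ h′ →
          a - b + (c - d) - (a′ - b′ + (c′ - d′)) + (e - f + (g - h) - (e′ - f′ + (g′ - h′)))
            ≡ a - b - a′ + b′ + (g - h - g′ + h′) + (c - d - c′ + d′ + (e - f - e′ + f′))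
        identity = solve-∀
        expand : ∀ s t → ∑[ i < 4 ] (sgn i * R (pos i s) t) ≡ Δpp s t + Δqq s t + (Δpq s t + Δqp s t)
        expand s t = trans (alternate (R (pos 0F s) t) (R (pos 1F s) t) (R (pos 2F s) t) (R (pos 3F s) t))
          (trans (cong₂ _+_ (cong₂ _-_ (row 0F) (row 1F)) (cong₂ _-_ (row 2F) (row 3F)))
            (identity (k 0F 0F) (k 0F 1F) (k 0F 2F) (k 0F 3F) (k 1F 0F) (k 1F 1F) (k 1F 2F) (k 1F 3F)
                      (k 2F 0F) (k 2F 1F) (k 2F 2F) (k 2F 3F) (k 3F 0F) (k 3F 1F) (k 3F 2F) (k 3F 3F)))
          where
          k : Fin 4 → Fin 4 → ℤ
          k i j = K (pos i s) (pos j t)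
          row : ∀ i → R (pos i s) t ≡ k i 0F - k i 1F + (k i 2F - k i 3F)
          row i = alternate (k i 0F) (k i 1F) (k i 2F) (k i 3F)

      -- Each of the h² pairs (s, t) gains at least 1 from the P-Q interactions, while the P-P and
      -- Q-Q interactions have nonpositive totals after symmetrisation.
      ∑∑-dipoles≤ :
        (∀ s t → Δpp s t + Δpp t s ≤ 0ℤ) → (∀ s t → Δqq s t + Δqq t s ≤ 0ℤ) →
        (∀ s t → Δpq s t + Δqp s t ≤ -1ℤ) →
        ∑[ u < n ] ∑[ v < n ] (dipoles u * dipoles v * K u v) ≤ - (+ h * + h)
      ∑∑-dipoles≤ pp qq pq = begin
        ∑[ u < n ] ∑[ v < n ] (dipoles u * dipoles v * K u v)
          ≡⟨ ∑∑-dipoles ⟩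
        ∑[ s < h ] ∑[ t < h ] (Δpp s t + Δqq s t + (Δpq s t + Δqp s t))
          ≡⟨ split (λ s t → Δpp s t + Δqq s t) (λ s t → Δpq s t + Δqp s t) ⟩
        ∑[ s < h ] ∑[ t < h ] (Δpp s t + Δqq s t) + ∑[ s < h ] ∑[ t < h ] (Δpq s t + Δqp s t)
          ≡⟨ cong (_+ ∑[ s < h ] ∑[ t < h ] (Δpq s t + Δqp s t)) (split Δpp Δqq) ⟩
        ∑[ s < h ] ∑[ t < h ] Δpp s t + ∑[ s < h ] ∑[ t < h ] Δqq s t
          + ∑[ s < h ] ∑[ t < h ] (Δpq s t + Δqp s t)
          ≤⟨ +-mono-≤ (+-mono-≤ (∑∑-antisymmetric Δpp pp) (∑∑-antisymmetric Δqq qq))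
                      (sum-mono {h} λ s → sum-mono {h} λ t → pq s t) ⟩
        0ℤ + 0ℤ + ∑[ s < h ] ∑[ t < h ] -1ℤ
          ≡⟨ trans (+-identityˡ (∑[ s < h ] ∑[ t < h ] -1ℤ)) (trans (sum-cong-≗ {h} λ _ → sum-const h -1ℤ) (sum-const h (+ h * -1ℤ))) ⟩
        + h * (+ h * -1ℤ)
          ≡⟨ collect (+ h) ⟩
        - (+ h * + h) ∎
        where
        open ≤-Reasoning
        split : (F G : Fin h → Fin h → ℤ) → ∑[ s < h ] ∑[ t < h ] (F s t + G s t)
              ≡ ∑[ s < h ] ∑[ t < h ] F s t + ∑[ s < h ] ∑[ t < h ] G s t
        split F G = trans (sum-cong-≗ {h} λ s → ∑-distrib-+ (F s) (G s))
                          (∑-distrib-+ (λ s → sum (F s)) (λ s → sum (G s)))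
        collect : ∀ h → h * (h * -1ℤ) ≡ - (h * h)
        collect = solve-∀

  -- Blocks

  block-mono : ∀ h {u v} (s t : Fin h) → u ℕ.< v → h ℕ.* u ℕ.+ toℕ s ℕ.< h ℕ.* v ℕ.+ toℕ t
  block-mono h {u} {v} s t u<v = begin-strict
    h ℕ.* u ℕ.+ toℕ s <⟨ ℕP.+-monoʳ-< (h ℕ.* u) (Fin.toℕ<n s) ⟩
    h ℕ.* u ℕ.+ h     ≡⟨ trans (ℕP.+-comm (h ℕ.* u) h) (sym (ℕP.*-suc h u)) ⟩
    h ℕ.* suc u       ≤⟨ ℕP.*-monoʳ-≤ h u<v ⟩
    h ℕ.* v           ≤⟨ ℕP.m≤m+n (h ℕ.* v) (toℕ t) ⟩
    h ℕ.* v ℕ.+ toℕ t ∎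
    where open ℕP.≤-Reasoning

  division-injective : ∀ h u v (s t : Fin h) → h ℕ.* u ℕ.+ toℕ s ≡ h ℕ.* v ℕ.+ toℕ t → u ≡ v × s ≡ t
  division-injective h u v s t eq with ℕP.<-cmp u v
  ... | tri≈ _ refl _ = refl , Fin.toℕ-injective (ℕP.+-cancelˡ-≡ (h ℕ.* u) _ _ eq)
  ... | tri< u<v _ _ = ⊥-elim (ℕP.<⇒≢ (block-mono h s t u<v) eq)
  ... | tri> _ _ v<u = ⊥-elim (ℕP.<⇒≢ (block-mono h t s v<u) (sym eq))

  module Blocks (n h M κ : ℕ) (κ<M : κ ℕ.< M) (u : Fin 4 → ℕ)
    (u-injective : ∀ i j → u i ≡ u j → i ≡ j) (0<u : ∀ i → 0 ℕ.< u i)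
    (fits : ∀ i → M ℕ.* h ℕ.* suc (u i) ℕ.≤ n) where

    instance
      M≢0 : NonZero M
      M≢0 = ℕ.>-nonZero (ℕP.≤-<-trans z≤n κ<M)

    -- `A i` runs through h consecutive integers, so `X i` is a progression of step M; all four
    -- blocks lie in the residue class of κ modulo M.
    A X : Fin 4 → Fin h → ℕ
    A i t = h ℕ.* u i ℕ.+ toℕ t
    X i t = M ℕ.* A i t ℕ.+ κ

    X-lower : ∀ i t → M ℕ.* h ℕ.* u i ℕ.≤ X i t
    X-lower i t = begin
      M ℕ.* h ℕ.* u i   ≡⟨ ℕP.*-assoc M h (u i) ⟩
      M ℕ.* (h ℕ.* u i) ≤⟨ ℕP.*-monoʳ-≤ M (ℕP.m≤m+n (h ℕ.* u i) (toℕ t)) ⟩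
      M ℕ.* A i t       ≤⟨ ℕP.m≤m+n (M ℕ.* A i t) κ ⟩
      X i t             ∎
      where open ℕP.≤-Reasoning

    X-upper : ∀ i t → X i t ℕ.< M ℕ.* h ℕ.* suc (u i)
    X-upper i t = begin-strict
      M ℕ.* A i t ℕ.+ κ           <⟨ ℕP.+-monoʳ-< (M ℕ.* A i t) κ<M ⟩
      M ℕ.* A i t ℕ.+ M           ≡⟨ trans (ℕP.+-comm (M ℕ.* A i t) M) (sym (ℕP.*-suc M (A i t))) ⟩
      M ℕ.* suc (A i t)           ≤⟨ ℕP.*-monoʳ-≤ M (ℕP.+-monoʳ-< (h ℕ.* u i) (Fin.toℕ<n t)) ⟩
      M ℕ.* (h ℕ.* u i ℕ.+ h)     ≡⟨ distribute M h (u i) ⟩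
      M ℕ.* h ℕ.* suc (u i)       ∎
      where
      open ℕP.≤-Reasoning
      distribute : ∀ M h u → M ℕ.* (h ℕ.* u ℕ.+ h) ≡ M ℕ.* h ℕ.* (1 ℕ.+ u)
      distribute = ℕSolver.solve-∀

    0<X : ∀ i t → 0 ℕ.< X i t
    0<X i t = ℕP.<-≤-trans (ℕ.>-nonZero⁻¹ (M ℕ.* h ℕ.* u i)) (X-lower i t)
      where instance
        h≢0 : NonZero h
        h≢0 = ℕ.>-nonZero (ℕP.≤-<-trans z≤n (Fin.toℕ<n t))
        u≢0 : NonZero (u i)
        u≢0 = ℕ.>-nonZero (0<u i)
        Mh≢0 : NonZero (M ℕ.* h)
        Mh≢0 = ℕP.m*n≢0 M h
        Mhu≢0 : NonZero (M ℕ.* h ℕ.* u i)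
        Mhu≢0 = ℕP.m*n≢0 (M ℕ.* h) (u i)

    X≤n : ∀ i t → X i t ℕ.≤ n
    X≤n i t = ℕP.≤-trans (ℕP.<⇒≤ (X-upper i t)) (fits i)

    suc-pred-X : ∀ i t → suc (ℕ.pred (X i t)) ≡ X i t
    suc-pred-X i t = ℕP.suc-pred (X i t) ⦃ ℕ.>-nonZero (0<X i t) ⦄

    pos : Fin 4 → Fin h → Fin n
    -- The element k of `Fin n` stands for the integer k + 1, hence the predecessor.
    pos i t = fromℕ< {ℕ.pred (X i t)} (subst (ℕ._≤ n) (sym (suc-pred-X i t)) (X≤n i t))

    suc-toℕ-pos : ∀ i t → suc (toℕ (pos i t)) ≡ X i t
    suc-toℕ-pos i t = trans (cong suc (Fin.toℕ-fromℕ< _)) (suc-pred-X i t)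

    val-pos : ∀ i t → val (pos i t) ≡ + X i t
    val-pos i t = cong +_ (suc-toℕ-pos i t)

    pos-injective : ∀ i j s t → pos i s ≡ pos j t → i ≡ j × s ≡ t
    pos-injective i j s t eq =
      let X≡ = trans (sym (suc-toℕ-pos i s)) (trans (cong (suc ∘ toℕ) eq) (suc-toℕ-pos j t))
          A≡ = ℕP.*-cancelˡ-≡ (A i s) (A j t) M (ℕP.+-cancelʳ-≡ κ (M ℕ.* A i s) (M ℕ.* A j t) X≡)
          u≡ , s≡t = division-injective h (u i) (u j) s t A≡
      in u-injective i j u≡ , s≡t

    open Dipoles pos pos-injective public

    Δ-+ : ∀ (K L : Fin n → Fin n → ℤ) x x′ y y′ →
      Δ (λ u v → K u v + L u v) x x′ y y′ ≡ Δ K x x′ y y′ + Δ L x x′ y y′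
    Δ-+ K L x x′ y y′ = identity (K x y) (K x y′) (K x′ y) (K x′ y′) (L x y) (L x y′) (L x′ y) (L x′ y′)
      where
      identity : ∀ a b c d e f g h →
        a + e - (b + f) - (c + g) + (d + h) ≡ a - b - c + d + (e - f - g + h)
      identity = solve-∀

    -- The hypotheses of `∑∑-dipoles≤` with c in place of -1. In this form they add up over the
    -- three summands of `W`.
    record Bounded (K : Fin n → Fin n → ℤ) (c : ℤ) : Set where
      field
        pp≤ : ∀ s t → Δpp K s t + Δpp K t s ≤ 0ℤ
        qq≤ : ∀ s t → Δqq K s t + Δqq K t s ≤ 0ℤ
        pq≤ : ∀ s t → Δpq K s t + Δqp K s t ≤ c
    open Bounded

    Bounded-+ : ∀ {K L c d} → Bounded K c → Bounded L d → Bounded (λ u v → K u v + L u v) (c + d)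
    Bounded-+ {K} {L} {c} {d} BK BL = record
      { pp≤ = λ s t → add 0F 1F 0F 1F s t 0F 1F 0F 1F t s (pp≤ BK s t) (pp≤ BL s t)
      ; qq≤ = λ s t → add 2F 3F 2F 3F s t 2F 3F 2F 3F t s (qq≤ BK s t) (qq≤ BL s t)
      ; pq≤ = λ s t → add 0F 1F 2F 3F s t 2F 3F 0F 1F s t (pq≤ BK s t) (pq≤ BL s t)
      }
      where
      interchange : ∀ a b c d → a + b + (c + d) ≡ a + c + (b + d)
      interchange = solve-∀
      add : ∀ i i′ j j′ s t k k′ l l′ s′ t′ {c d} →
        Δ K (pos i s) (pos i′ s) (pos j t) (pos j′ t) + Δ K (pos k s′) (pos k′ s′) (pos l t′) (pos l′ t′) ≤ c →
        Δ L (pos i s) (pos i′ s) (pos j t) (pos j′ t) + Δ L (pos k s′) (pos k′ s′) (pos l t′) (pos l′ t′) ≤ d →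
        Δ (λ u v → K u v + L u v) (pos i s) (pos i′ s) (pos j t) (pos j′ t)
          + Δ (λ u v → K u v + L u v) (pos k s′) (pos k′ s′) (pos l t′) (pos l′ t′) ≤ c + d
      add i i′ j j′ s t k k′ l l′ s′ t′ p q = ≤-trans (≤-reflexive (trans
        (cong₂ _+_ (Δ-+ K L (pos i s) (pos i′ s) (pos j t) (pos j′ t)) (Δ-+ K L (pos k s′) (pos k′ s′) (pos l t′) (pos l′ t′)))
        (interchange (Δ K (pos i s) (pos i′ s) (pos j t) (pos j′ t)) (Δ L (pos i s) (pos i′ s) (pos j t) (pos j′ t))
                     (Δ K (pos k s′) (pos k′ s′) (pos l t′) (pos l′ t′)) (Δ L (pos k s′) (pos k′ s′) (pos l t′) (pos l′ t′)))))
        (+-mono-≤ p q)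

    E-dipoles≤ : ∀ a b c → let open QuadraticForm (ω a b c {n}) in Bounded W -1ℤ → E dipoles ≤ - (+ h * + h)
    E-dipoles≤ a b c B = ≤-trans (≤-reflexive (QuadraticForm.E≡bilinear (ω a b c {n}) dipoles))
      (∑∑-dipoles≤ (QuadraticForm.W (ω a b c {n})) (pp≤ B) (qq≤ B) (pq≤ B))

    Δ-eval : ∀ (K : Fin n → Fin n → ℤ) {x x′ y y′ a b c d} →
      K x y ≡ a → K x y′ ≡ b → K x′ y ≡ c → K x′ y′ ≡ d → Δ K x x′ y y′ ≡ a - b - c + d
    Δ-eval K refl refl refl refl = refl

    constant⇒Bounded : ∀ K e → (∀ i s j t → K (pos i s) (pos j t) ≡ e) → Bounded K 0ℤ
    constant⇒Bounded K e const = record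
      { pp≤ = λ s t → ≤-reflexive (cong₂ _+_ (zero-Δ 0F 1F 0F 1F s t) (zero-Δ 0F 1F 0F 1F t s))
      ; qq≤ = λ s t → ≤-reflexive (cong₂ _+_ (zero-Δ 2F 3F 2F 3F s t) (zero-Δ 2F 3F 2F 3F t s))
      ; pq≤ = λ s t → ≤-reflexive (cong₂ _+_ (zero-Δ 0F 1F 2F 3F s t) (zero-Δ 2F 3F 0F 1F s t))
      }
      where
      cancel : ∀ e → e - e - e + e ≡ 0ℤ
      cancel = solve-∀
      zero-Δ : ∀ i i′ j j′ s t → Δ K (pos i s) (pos i′ s) (pos j t) (pos j′ t) ≡ 0ℤ
      zero-Δ i i′ j j′ s t = trans (Δ-eval K (const i s j t) (const i s j′ t) (const i′ s j t) (const i′ s j′ t)) (cancel e)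

    -- This is the shape of the number of positive w with r w = q y - p x when r divides the right
    -- side and the range of w is no obstruction: only the sign of q y - p x matters.
    record Threshold (K : Fin n → Fin n → ℤ) (p q : ℕ) : Set where
      field
        above : ∀ i s j t → p ℕ.* X i s ℕ.< q ℕ.* X j t → K (pos i s) (pos j t) ≡ 1ℤ
        below : ∀ i s j t → q ℕ.* X j t ℕ.≤ p ℕ.* X i s → K (pos i s) (pos j t) ≡ 0ℤ

    -- Block i lies in the half-open interval [H u, H (u + 1)) with H = M h and u = u i.
    block-< : ∀ p q i s j t → .⦃ NonZero p ⦄ → p ℕ.* suc (u i) ℕ.≤ q ℕ.* u j → p ℕ.* X i s ℕ.< q ℕ.* X j t
    block-< p q i s j t le = begin-strict
      p ℕ.* X i s                     <⟨ ℕP.*-monoʳ-< p (X-upper i s) ⟩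
      p ℕ.* (M ℕ.* h ℕ.* suc (u i))   ≡⟨ swap p (M ℕ.* h) (suc (u i)) ⟩
      M ℕ.* h ℕ.* (p ℕ.* suc (u i))   ≤⟨ ℕP.*-monoʳ-≤ (M ℕ.* h) le ⟩
      M ℕ.* h ℕ.* (q ℕ.* u j)         ≡⟨ swap q (M ℕ.* h) (u j) ⟨
      q ℕ.* (M ℕ.* h ℕ.* u j)         ≤⟨ ℕP.*-monoʳ-≤ q (X-lower j t) ⟩
      q ℕ.* X j t                     ∎
      where
      open ℕP.≤-Reasoning
      swap : ∀ p H v → p ℕ.* (H ℕ.* v) ≡ H ℕ.* (p ℕ.* v)
      swap = ℕSolver.solve-∀

    module _ {K p q} .⦃ _ : NonZero p ⦄ .⦃ _ : NonZero q ⦄ (T : Threshold K p q) where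
      open Threshold T

      K≡1 : ∀ i s j t → p ℕ.* suc (u i) ℕ.≤ q ℕ.* u j → K (pos i s) (pos j t) ≡ 1ℤ
      K≡1 i s j t le = above i s j t (block-< p q i s j t le)

      K≡0 : ∀ i s j t → q ℕ.* suc (u j) ℕ.≤ p ℕ.* u i → K (pos i s) (pos j t) ≡ 0ℤ
      K≡0 i s j t le = below i s j t (ℕP.<⇒≤ (block-< q p j t i s le))

      Δ-below : ∀ i i′ j j′ s t → p ℕ.* suc (u i) ℕ.≤ q ℕ.* u j → p ℕ.* suc (u i) ℕ.≤ q ℕ.* u j′ →
        p ℕ.* suc (u i′) ℕ.≤ q ℕ.* u j → p ℕ.* suc (u i′) ℕ.≤ q ℕ.* u j′ →
        Δ K (pos i s) (pos i′ s) (pos j t) (pos j′ t) ≡ 0ℤ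
      Δ-below i i′ j j′ s t a b c d =
        Δ-eval K (K≡1 i s j t a) (K≡1 i s j′ t b) (K≡1 i′ s j t c) (K≡1 i′ s j′ t d)

      Δ-above : ∀ i i′ j j′ s t → q ℕ.* suc (u j) ℕ.≤ p ℕ.* u i → q ℕ.* suc (u j′) ℕ.≤ p ℕ.* u i →
        q ℕ.* suc (u j) ℕ.≤ p ℕ.* u i′ → q ℕ.* suc (u j′) ℕ.≤ p ℕ.* u i′ →
        Δ K (pos i s) (pos i′ s) (pos j t) (pos j′ t) ≡ 0ℤ
      Δ-above i i′ j j′ s t a b c d =
        Δ-eval K (K≡0 i s j t a) (K≡0 i s j′ t b) (K≡0 i′ s j t c) (K≡0 i′ s j′ t d)

      -- Of the four pairs only (i, j′) passes the threshold. It joins opposite charges, so it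
      -- enters with a minus sign; this is the source of all the gain when α ≠ γ.
      Δ-critical : ∀ i i′ j j′ s t → q ℕ.* suc (u j) ℕ.≤ p ℕ.* u i → p ℕ.* suc (u i) ℕ.≤ q ℕ.* u j′ →
        q ℕ.* suc (u j) ℕ.≤ p ℕ.* u i′ → q ℕ.* suc (u j′) ℕ.≤ p ℕ.* u i′ →
        Δ K (pos i s) (pos i′ s) (pos j t) (pos j′ t) ≡ -1ℤ
      Δ-critical i i′ j j′ s t a b c d =
        Δ-eval K (K≡0 i s j t a) (K≡1 i s j′ t b) (K≡0 i′ s j t c) (K≡0 i′ s j′ t d)

    module _ {K p} .⦃ _ : NonZero p ⦄ (T : Threshold K p p) where
      open Threshold T

      K+Kᵀ≤1 : ∀ i s t → K (pos i s) (pos i t) + K (pos i t) (pos i s) ≤ 1ℤ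
      K+Kᵀ≤1 i s t with p ℕ.* X i s ℕP.<? p ℕ.* X i t
      ... | yes lt = ≤-reflexive (cong₂ _+_ (above i s i t lt) (below i t i s (ℕP.<⇒≤ lt)))
      ... | no ≮ = ≤-trans (≤-reflexive (cong (_+ K (pos i t) (pos i s)) (below i s i t (ℕP.≮⇒≥ ≮)))) bound
        where
        bound : 0ℤ + K (pos i t) (pos i s) ≤ 1ℤ
        bound with p ℕ.* X i t ℕP.<? p ℕ.* X i s
        ... | yes lt = ≤-reflexive (+-congˡ 0ℤ (above i t i s lt))
        ... | no ≮′ = ≤-trans (≤-reflexive (+-congˡ 0ℤ (below i t i s (ℕP.≮⇒≥ ≮′)))) (+≤+ z≤n)

      -- For p = q the order of two elements of one block is not decided by the block, but x < y and
      -- y < x exclude each other. Each block thus gives at most 1 to the symmetrised sum, and the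
      -- two cross terms, decided by u i < u i′, remove 2.
      Δ-self : ∀ i i′ s t → u i ℕ.< u i′ →
        Δ K (pos i s) (pos i′ s) (pos i t) (pos i′ t) + Δ K (pos i t) (pos i′ t) (pos i s) (pos i′ s) ≤ 0ℤ
      Δ-self i i′ s t lt = begin
        Δ K (pos i s) (pos i′ s) (pos i t) (pos i′ t) + Δ K (pos i t) (pos i′ t) (pos i s) (pos i′ s)
          ≡⟨ cong₂ _+_ (Δ-eval K refl (one s t) (nil s t) refl) (Δ-eval K refl (one t s) (nil t s) refl) ⟩
        a - 1ℤ - 0ℤ + b + (a′ - 1ℤ - 0ℤ + b′)
          ≡⟨ regroup a b a′ b′ ⟩
        a + a′ + (b + b′) - + 2
          ≤⟨ +-monoˡ-≤ (- + 2) (+-mono-≤ (K+Kᵀ≤1 i s t) (K+Kᵀ≤1 i′ s t)) ⟩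
        0ℤ ∎
        where
        open ≤-Reasoning
        a b a′ b′ : ℤ
        a = K (pos i s) (pos i t)
        b = K (pos i′ s) (pos i′ t)
        a′ = K (pos i t) (pos i s)
        b′ = K (pos i′ t) (pos i′ s)
        one : ∀ s t → K (pos i s) (pos i′ t) ≡ 1ℤ
        one s t = K≡1 T i s i′ t (ℕP.*-monoʳ-≤ p lt)
        nil : ∀ s t → K (pos i′ s) (pos i t) ≡ 0ℤ
        nil s t = K≡0 T i′ s i t (ℕP.*-monoʳ-≤ p lt)
        regroup : ∀ a b a′ b′ → a - 1ℤ - 0ℤ + b + (a′ - 1ℤ - 0ℤ + b′) ≡ a + a′ + (b + b′) - + 2
        regroup = solve-∀

  -- Counting the third variable

  module LinearCount {n} {P : Fin n → Set} (P? : ∀ w → Dec (P w)) (r : ℕ) .⦃ _ : NonZero r ⦄ (L : ℤ)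
    (to : ∀ {w} → P w → + r * val w ≡ L) (from : ∀ {w} → + r * val w ≡ L → P w) where

    private
      r*val : ∀ (w : Fin n) → + r * val w ≡ + (r ℕ.* suc (toℕ w))
      r*val w = sym (pos-* r (suc (toℕ w)))

    count-indivisible : ¬ (+ r ∣ L) → ∑[ w < n ] 𝟙 (P? w) ≡ 0ℤ
    count-indivisible r∤L = sum-𝟙-none P? λ w p →
      r∤L (divides (val w) (trans (sym (to p)) (*-comm (+ r) (val w))))

    count-nonpositive : L ≤ 0ℤ → ∑[ w < n ] 𝟙 (P? w) ≡ 0ℤ
    count-nonpositive L≤0 = sum-𝟙-none P? λ w p →
      ℕP.n≮0 (ℕP.<-≤-trans (ℕ.>-nonZero⁻¹ (r ℕ.* suc (toℕ w)) ⦃ ℕP.m*n≢0 r (suc (toℕ w)) ⦄)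
        (drop‿+≤+ (≤-trans (≤-reflexive (trans (sym (r*val w)) (to p))) L≤0)))

    count-large : + (r ℕ.* n) < L → ∑[ w < n ] 𝟙 (P? w) ≡ 0ℤ
    count-large large = sum-𝟙-none P? λ w p →
      ℕP.<⇒≱ (drop‿+<+ (<-≤-trans large (≤-reflexive (trans (sym (to p)) (r*val w)))))
        (ℕP.*-monoʳ-≤ r (Fin.toℕ<n w))

    -- The quotient L / r is positive, and it is at most n because r ≥ 1 and L ≤ n, so it is the
    -- value of exactly one element.
    count-one : + r ∣ L → 0ℤ < L → L ≤ + n → ∑[ w < n ] 𝟙 (P? w) ≡ 1ℤ
    count-one (divides (+ zero) refl) (+<+ ()) _
    count-one (divides -[1+ k ] eq) 0<L _ = ⊥-elim (<-asym 0<L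
      (≤-<-trans (≤-reflexive eq) (*-monoʳ-<-pos (+ r) ⦃ positive (+<+ (ℕ.>-nonZero⁻¹ r)) ⦄ { -[1+ k ]} {0ℤ} -<+)))
    count-one (divides (+ suc k) eq) 0<L L≤n =
      sum-𝟙-unique P? (λ {i} {j} p q → coefficient-cancel (+ r) (ℕ.≢-nonZero⁻¹ r ∘ +-injective) (trans (to p) (sym (to q))))
        {fromℕ< k<n} (from (begin
          + r * val (fromℕ< k<n) ≡⟨ cong (λ i → + r * + suc i) (Fin.toℕ-fromℕ< k<n) ⟩
          + r * + suc k ≡⟨ *-comm (+ r) (+ suc k) ⟩
          + suc k * + r ≡⟨ eq ⟨
          L ∎))
      where
      open ≡-Reasoning
      k<n : k ℕ.< n
      k<n = ℕP.≤-trans (ℕP.m≤m*n (suc k) r)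
        (drop‿+≤+ (≤-trans (≤-reflexive (trans (pos-* (suc k) r) (sym eq))) L≤n))

  -- On the class of κ modulo M, a form p x + q y is (p + q)κ plus a multiple of M. Its divisibility
  -- by a divisor of M is therefore the same for all elements of the blocks.
  residue : ∀ p q M A B κ → p * (M * A + κ) + q * (M * B + κ) ≡ (p * A + q * B) * M + (p + q) * κ
  residue = solve-∀

  -- The integers p c < q c′ differ by at least 1, so after scaling by S they leave a gap of at
  -- least S. The offset (at most 3c) and the block width (1 ≤ c) together use up at most 4 p c ≤ S
  -- of it.
  far : ∀ p c q c′ o o′ S → .⦃ NonZero c ⦄ → 4 ℕ.* (p ℕ.* c) ℕ.≤ S → o ℕ.≤ 3 → p ℕ.* c ℕ.< q ℕ.* c′ →
    p ℕ.* suc (c ℕ.* (S ℕ.+ o)) ℕ.≤ q ℕ.* (c′ ℕ.* (S ℕ.+ o′))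
  far p c q c′ o o′ S 4pc≤S o≤3 lt = begin
    p ℕ.* suc (c ℕ.* (S ℕ.+ o))
      ≤⟨ ℕP.*-monoʳ-≤ p (ℕP.+-mono-≤ (ℕ.>-nonZero⁻¹ c) (ℕP.*-monoʳ-≤ c (ℕP.+-monoʳ-≤ S o≤3))) ⟩
    p ℕ.* (c ℕ.+ c ℕ.* (S ℕ.+ 3)) ≡⟨ regroup p c S ⟩
    4 ℕ.* (p ℕ.* c) ℕ.+ p ℕ.* c ℕ.* S ≤⟨ ℕP.+-monoˡ-≤ (p ℕ.* c ℕ.* S) 4pc≤S ⟩
    suc (p ℕ.* c) ℕ.* S ≤⟨ ℕP.*-monoˡ-≤ S lt ⟩
    q ℕ.* c′ ℕ.* S ≡⟨ ℕP.*-assoc q c′ S ⟩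
    q ℕ.* (c′ ℕ.* S) ≤⟨ ℕP.*-monoʳ-≤ q (ℕP.*-monoʳ-≤ c′ (ℕP.m≤m+n S o′)) ⟩
    q ℕ.* (c′ ℕ.* (S ℕ.+ o′)) ∎
    where
    open ℕP.≤-Reasoning
    regroup : ∀ p c S → p ℕ.* (c ℕ.+ c ℕ.* (S ℕ.+ 3)) ≡ 4 ℕ.* (p ℕ.* c) ℕ.+ p ℕ.* c ℕ.* S
    regroup = ℕSolver.solve-∀

  -- Pair counts on a residue class

  module Kernel (n h M κ : ℕ) (κ<M : κ ℕ.< M) (u : Fin 4 → ℕ)
    (u-injective : ∀ i j → u i ≡ u j → i ≡ j) (0<u : ∀ i → 0 ℕ.< u i)
    (fits : ∀ i → M ℕ.* h ℕ.* suc (u i) ℕ.≤ n)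
    {P : Fin n → Fin n → Fin n → Set} (P? : ∀ x y w → Dec (P x y w))
    (r : ℕ) .⦃ _ : NonZero r ⦄ (p q : ℤ)
    (to : ∀ x y w → P x y w → + r * val w ≡ p * val x + q * val y)
    (from : ∀ x y w → + r * val w ≡ p * val x + q * val y → P x y w)
    (r∣M : + r ∣ + M) where

    open Blocks n h M κ κ<M u u-injective 0<u fits

    K : Fin n → Fin n → ℤ
    K x y = ∑[ w < n ] 𝟙 (P? x y w)

    private
      L : Fin 4 → Fin h → Fin 4 → Fin h → ℤ
      L i s j t = p * val (pos i s) + q * val (pos j t)

      module Count i s j t = LinearCount (P? (pos i s) (pos j t)) r (L i s j t)
        (λ {w} → to (pos i s) (pos j t) w) (λ {w} → from (pos i s) (pos j t) w)

      val-residue : ∀ i s → val (pos i s) ≡ + M * + A i s + + κ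
      val-residue i s = trans (val-pos i s) (cong (_+ + κ) (pos-* M (A i s)))

      L-residue : ∀ i s j t → L i s j t ≡ (p * + A i s + q * + A j t) * + M + (p + q) * + κ
      L-residue i s j t = trans
        (cong₂ (λ X Y → p * X + q * Y) (val-residue i s) (val-residue j t))
        (residue p q (+ M) (+ A i s) (+ A j t) (+ κ))

    -- Whether r divides p x + q y on the blocks is decided by κ alone. In the dead case no pair
    -- extends to a solution, so the count is constantly 0; in the alive case it depends only on the
    -- size of p x + q y.
    dead⇒Bounded : ¬ (+ r ∣ (p + q) * + κ) → Bounded K 0ℤ
    dead⇒Bounded dead = constant⇒Bounded K 0ℤ λ i s j t → Count.count-indivisible i s j t λ r∣L →
      dead (∣m+n∣m⇒∣n (subst (+ r ∣_) (L-residue i s j t) r∣L)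
        (∣n⇒∣m*n (p * + A i s + q * + A j t) r∣M))

    module Alive (alive : + r ∣ (p + q) * + κ) where

      r∣L : ∀ i s j t → + r ∣ L i s j t
      r∣L i s j t = subst (+ r ∣_) (sym (L-residue i s j t))
        (∣m∣n⇒∣m+n (∣n⇒∣m*n (p * + A i s + q * + A j t) r∣M) alive)

      alive-one : ∀ i s j t → 0ℤ < L i s j t → L i s j t ≤ + n → K (pos i s) (pos j t) ≡ 1ℤ
      alive-one i s j t = Count.count-one i s j t (r∣L i s j t)

      alive⇒Bounded : (∀ i s j t → 0ℤ < L i s j t) → (∀ i s j t → L i s j t ≤ + n) → Bounded K 0ℤ
      alive⇒Bounded 0<L L≤n = constant⇒Bounded K 1ℤ λ i s j t → alive-one i s j t (0<L i s j t) (L≤n i s j t)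

      large-zero : ∀ i s j t → + (r ℕ.* n) < L i s j t → K (pos i s) (pos j t) ≡ 0ℤ
      large-zero i s j t = Count.count-large i s j t

      -- Here p is negative, and q′ y - p′ x ≤ q′ y ≤ n, so the count is 1 or 0 according to whether
      -- p′ x < q′ y.
      alive⇒Threshold : ∀ p′ q′ → p ≡ - + p′ → q ≡ + q′ → (∀ j t → q′ ℕ.* X j t ℕ.≤ n) → Threshold K p′ q′
      alive⇒Threshold p′ q′ p≡ q≡ small = record
        { above = λ i s j t lt → alive-one i s j t
            (subst (0ℤ <_) (sym (L≡ i s j t)) (subst (_< + (q′ ℕ.* X j t) - + (p′ ℕ.* X i s))
              (+-inverseʳ (+ (p′ ℕ.* X i s))) (+-monoˡ-< (- + (p′ ℕ.* X i s)) (+<+ lt))))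
            (≤-trans (≤-reflexive (L≡ i s j t)) (≤-trans (i≤j⇒i-k≤j (+ (p′ ℕ.* X i s)) ≤-refl) (+≤+ (small j t))))
        ; below = λ i s j t le → Count.count-nonpositive i s j t
            (≤-trans (≤-reflexive (L≡ i s j t)) (i≤j⇒i-j≤0 (+≤+ le)))
        }
        where
        rearrange : ∀ p q x y → - p * x + q * y ≡ q * y - p * x
        rearrange = solve-∀
        L≡ : ∀ i s j t → L i s j t ≡ + (q′ ℕ.* X j t) - + (p′ ℕ.* X i s)
        L≡ i s j t = begin
          p * val (pos i s) + q * val (pos j t)
            ≡⟨ cong₂ _+_ (cong₂ _*_ p≡ (val-pos i s)) (cong₂ _*_ q≡ (val-pos j t)) ⟩
          - + p′ * + X i s + + q′ * + X j t
            ≡⟨ rearrange (+ p′) (+ q′) (+ X i s) (+ X j t) ⟩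
          + q′ * + X j t - + p′ * + X i s
            ≡⟨ cong₂ _-_ (pos-* q′ (X j t)) (pos-* p′ (X i s)) ⟨
          + (q′ ℕ.* X j t) - + (p′ ℕ.* X i s) ∎
          where open ≡-Reasoning

  -- Four blocks near the ratio α : γ

  module Isolate (α β γ : ℤ) {n : ℕ} where

    private
      by-difference : ∀ {e l r} → e ≡ l - r → (e ≡ 0ℤ → l ≡ r) × (l ≡ r → e ≡ 0ℤ)
      by-difference {l = l} {r} refl = i-j≡0⇒i≡j l r , i≡j⇒i-j≡0

    isolate₁ : ∀ (y z x : Fin n) → (IsSol α β (- γ) (x , y , z) → α * val x ≡ - β * val y + γ * val z)
                                 × (α * val x ≡ - β * val y + γ * val z → IsSol α β (- γ) (x , y , z))
    isolate₁ y z x = by-difference (identity α β γ (val x) (val y) (val z))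
      where
      identity : ∀ a b g x y z → a * x + b * y + - g * z ≡ a * x - (- b * y + g * z)
      identity = solve-∀

    isolate₂ : ∀ (x z y : Fin n) → (IsSol α β (- γ) (x , y , z) → β * val y ≡ - α * val x + γ * val z)
                                 × (β * val y ≡ - α * val x + γ * val z → IsSol α β (- γ) (x , y , z))
    isolate₂ x z y = by-difference (identity α β γ (val x) (val y) (val z))
      where
      identity : ∀ a b g x y z → a * x + b * y + - g * z ≡ b * y - (- a * x + g * z)
      identity = solve-∀

    isolate₃ : ∀ (x y z : Fin n) → (IsSol α β (- γ) (x , y , z) → γ * val z ≡ α * val x + β * val y)
                                 × (γ * val z ≡ α * val x + β * val y → IsSol α β (- γ) (x , y , z))
    isolate₃ x y z = let f , g = by-difference (identity α β γ (val x) (val y) (val z)) in sym ∘ f , g ∘ sym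
      where
      identity : ∀ a b g x y z → a * x + b * y + - g * z ≡ a * x + b * y - g * z
      identity = solve-∀

  by-cases : ∀ {p q} {P : Set p} {Q : Set q} → Dec P → (¬ P → Q) → (P → Q) → Q
  by-cases (yes p) _ f = f p
  by-cases (no ¬p) g _ = g ¬p

  by-order : ∀ {a} {A : Set a} {m n : ℕ} → m ≢ n → (m ℕ.< n → A) → (n ℕ.< m → A) → A
  by-order {m = m} {n} m≢n f g with ℕP.<-cmp m n
  ... | tri< lt _ _ = f lt
  ... | tri≈ _ eq _ = ⊥-elim (m≢n eq)
  ... | tri> _ _ gt = g gt

  -- `alive₂` makes the threshold α x < γ z effective in the count of y. `dead₁` concerns β y < γ z
  -- with y in Q and z in P: these compare βαS with γ²S, and in case of equality the offsets would
  -- produce +1, offsetting the gain, so the count of x must then be dead.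
  module Generic (α β γ κ M S : ℕ) .⦃ _ : NonZero α ⦄ .⦃ _ : NonZero β ⦄ .⦃ _ : NonZero γ ⦄
    (κ<M : κ ℕ.< M) (α∣M : + α ∣ + M) (β∣M : + β ∣ + M) (γ∣M : + γ ∣ + M)
    (S-large : 4 ℕ.* ((α ℕ.+ β ℕ.+ γ) ℕ.* (α ℕ.+ γ)) ℕ.≤ S)
    (α≢γ : α ≢ γ)
    (alive₂ : + β ∣ (- + α + + γ) * + κ)
    (dead₁ : β ℕ.* α ≡ γ ℕ.* γ → ¬ (+ α ∣ (- + β + + γ) * + κ)) where

    private
      Σc U m : ℕ
      Σc = α ℕ.+ β ℕ.+ γ
      U = (α ℕ.+ γ) ℕ.* (S ℕ.+ 4)
      -- U bounds every `suc (u i)`. The factor `Σc` keeps γ z and α x + β y at most n on the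
      -- blocks, so the end of the interval never cuts off a solution.
      m = M ℕ.* U ℕ.* Σc

      α≤Σ : α ℕ.≤ Σc
      α≤Σ = ℕP.≤-trans (ℕP.m≤m+n α β) (ℕP.m≤m+n (α ℕ.+ β) γ)
      β≤Σ : β ℕ.≤ Σc
      β≤Σ = ℕP.≤-trans (ℕP.m≤n+m β α) (ℕP.m≤m+n (α ℕ.+ β) γ)
      γ≤Σ : γ ℕ.≤ Σc
      γ≤Σ = ℕP.m≤n+m γ (α ℕ.+ β)
      1≤Σ : 1 ℕ.≤ Σc
      1≤Σ = ℕP.≤-trans (ℕ.>-nonZero⁻¹ α) α≤Σ

      -- For x in P and z in Q both α x and γ z are close to αγS, and the offsets interleave as Q⁺ <
      -- P⁺ < Q⁻ < P⁻. Hence α x < γ z holds only for x in P⁺ and z in Q⁻.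
      c o u : Fin 4 → ℕ
      c 0F = γ
      c 1F = γ
      c 2F = α
      c 3F = α
      o 0F = 1
      o 1F = 3
      o 2F = 0
      o 3F = 2
      u i = c i ℕ.* (S ℕ.+ o i)

      c≢0 : ∀ i → NonZero (c i)
      c≢0 0F = ℕ.≢-nonZero (ℕ.≢-nonZero⁻¹ γ)
      c≢0 1F = ℕ.≢-nonZero (ℕ.≢-nonZero⁻¹ γ)
      c≢0 2F = ℕ.≢-nonZero (ℕ.≢-nonZero⁻¹ α)
      c≢0 3F = ℕ.≢-nonZero (ℕ.≢-nonZero⁻¹ α)

      c≤α+γ : ∀ i → c i ℕ.≤ α ℕ.+ γ
      c≤α+γ 0F = ℕP.m≤n+m γ α
      c≤α+γ 1F = ℕP.m≤n+m γ α
      c≤α+γ 2F = ℕP.m≤m+n α γ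
      c≤α+γ 3F = ℕP.m≤m+n α γ

      o≤3 : ∀ i → o i ℕ.≤ 3
      o≤3 = from-yes (Fin.all? λ i → o i ℕP.≤? 3)

      o-injective : ∀ i j → o i ≡ o j → i ≡ j
      o-injective = from-yes (Fin.all? λ i → Fin.all? λ j → (o i ℕP.≟ o j) →-dec (i Fin.≟ j))

      separate : ∀ p q i j → p ℕ.≤ Σc → p ℕ.* c i ℕ.< q ℕ.* c j → p ℕ.* suc (u i) ℕ.≤ q ℕ.* u j
      separate p q i j p≤Σ = far p (c i) q (c j) (o i) (o j) S ⦃ c≢0 i ⦄
        (ℕP.≤-trans (ℕP.*-monoʳ-≤ 4 (ℕP.*-mono-≤ p≤Σ (c≤α+γ i))) S-large) (o≤3 i)

      c<⇒u< : ∀ i j → c i ℕ.< c j → u i ℕ.< u j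
      c<⇒u< i j lt = subst₂ ℕ._≤_ (ℕP.*-identityˡ (suc (u i))) (ℕP.*-identityˡ (u j))
        (separate 1 1 i j 1≤Σ (subst₂ ℕ._<_ (sym (ℕP.*-identityˡ (c i))) (sym (ℕP.*-identityˡ (c j))) lt))

      u-injective : ∀ i j → u i ≡ u j → i ≡ j
      u-injective i j u≡ with ℕP.<-cmp (c i) (c j)
      ... | tri< lt _ _ = ⊥-elim (ℕP.<⇒≢ (c<⇒u< i j lt) u≡)
      ... | tri> _ _ gt = ⊥-elim (ℕP.<⇒≢ (c<⇒u< j i gt) (sym u≡))
      ... | tri≈ _ eq _ = o-injective i j (ℕP.+-cancelˡ-≡ S (o i) (o j)
        (ℕP.*-cancelˡ-≡ (S ℕ.+ o i) (S ℕ.+ o j) (c i) ⦃ c≢0 i ⦄ (trans u≡ (cong (ℕ._* (S ℕ.+ o j)) (sym eq)))))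

      0<S : 0 ℕ.< S
      0<S = ℕP.≤-trans (s≤s z≤n) (ℕP.≤-trans
        (ℕP.*-monoʳ-≤ 4 (ℕP.*-mono-≤ 1≤Σ (ℕP.≤-trans (ℕ.>-nonZero⁻¹ α) (ℕP.m≤m+n α γ)))) S-large)

      0<u : ∀ i → 0 ℕ.< u i
      0<u i = ℕP.*-mono-≤ (ℕ.>-nonZero⁻¹ (c i) ⦃ c≢0 i ⦄) (ℕP.≤-trans 0<S (ℕP.m≤m+n S (o i)))

      suc-u≤U : ∀ i → suc (u i) ℕ.≤ U
      suc-u≤U i = begin
        suc (c i ℕ.* (S ℕ.+ o i))
          ≤⟨ ℕP.+-mono-≤ (ℕ.>-nonZero⁻¹ (c i) ⦃ c≢0 i ⦄) (ℕP.*-monoʳ-≤ (c i) (ℕP.+-monoʳ-≤ S (o≤3 i))) ⟩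
        c i ℕ.+ c i ℕ.* (S ℕ.+ 3)   ≡⟨ regroup (c i) S ⟩
        c i ℕ.* (S ℕ.+ 4)           ≤⟨ ℕP.*-monoˡ-≤ (S ℕ.+ 4) (c≤α+γ i) ⟩
        U                           ∎
        where
        open ℕP.≤-Reasoning
        regroup : ∀ c S → c ℕ.+ c ℕ.* (S ℕ.+ 3) ≡ c ℕ.* (S ℕ.+ 4)
        regroup = ℕSolver.solve-∀

      module _ (n h : ℕ) (m*h≤n : suc m ℕ.* h ℕ.≤ n) where

        Σ*block≤n : ∀ i → Σc ℕ.* (M ℕ.* h ℕ.* suc (u i)) ℕ.≤ n
        Σ*block≤n i = begin
          Σc ℕ.* (M ℕ.* h ℕ.* suc (u i)) ≤⟨ ℕP.*-monoʳ-≤ Σc (ℕP.*-monoʳ-≤ (M ℕ.* h) (suc-u≤U i)) ⟩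
          Σc ℕ.* (M ℕ.* h ℕ.* U)         ≡⟨ regroup Σc M h U ⟩
          m ℕ.* h                        ≤⟨ ℕP.m≤n+m (m ℕ.* h) h ⟩
          suc m ℕ.* h                    ≤⟨ m*h≤n ⟩
          n                              ∎
          where
          open ℕP.≤-Reasoning
          regroup : ∀ s M h U → s ℕ.* (M ℕ.* h ℕ.* U) ≡ M ℕ.* U ℕ.* s ℕ.* h
          regroup = ℕSolver.solve-∀

        fits : ∀ i → M ℕ.* h ℕ.* suc (u i) ℕ.≤ n
        fits i = ℕP.≤-trans (ℕP.m≤n*m (M ℕ.* h ℕ.* suc (u i)) Σc ⦃ ℕ.>-nonZero 1≤Σ ⦄) (Σ*block≤n i)

        open Blocks n h M κ κ<M u u-injective 0<u fits
        open QuadraticForm (ω (+ α) (+ β) (- + γ) {n}) using (W; N₁₂; N₁₃; N₂₃)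
        open Isolate (+ α) (+ β) (+ γ) {n}

        Σ*X≤n : ∀ i t → Σc ℕ.* X i t ℕ.≤ n
        Σ*X≤n i t = ℕP.≤-trans (ℕP.*-monoʳ-≤ Σc (ℕP.<⇒≤ (X-upper i t))) (Σ*block≤n i)

        γ*X≤n : ∀ i t → γ ℕ.* X i t ℕ.≤ n
        γ*X≤n i t = ℕP.≤-trans (ℕP.*-monoˡ-≤ (X i t) γ≤Σ) (Σ*X≤n i t)

        α+β*X≤n : ∀ i t → α ℕ.* X i t ℕ.+ β ℕ.* X i t ℕ.≤ n
        α+β*X≤n i t = ℕP.≤-trans (ℕP.≤-reflexive (sym (ℕP.*-distribʳ-+ (X i t) α β)))
          (ℕP.≤-trans (ℕP.*-monoˡ-≤ (X i t) (ℕP.m≤m+n (α ℕ.+ β) γ)) (Σ*X≤n i t))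

        α*X+β*X≤n : ∀ i s j t → α ℕ.* X i s ℕ.+ β ℕ.* X j t ℕ.≤ n
        α*X+β*X≤n i s j t with ℕP.≤-total (X i s) (X j t)
        ... | inj₁ le = ℕP.≤-trans (ℕP.+-monoˡ-≤ (β ℕ.* X j t) (ℕP.*-monoʳ-≤ α le)) (α+β*X≤n j t)
        ... | inj₂ ge = ℕP.≤-trans (ℕP.+-monoʳ-≤ (α ℕ.* X i s) (ℕP.*-monoʳ-≤ β ge)) (α+β*X≤n i s)

        module K₁₂ = Kernel n h M κ κ<M u u-injective 0<u fits
          (λ x y z → isSol? (+ α) (+ β) (- + γ) (x , y , z)) γ (+ α) (+ β)
          (λ x y z → proj₁ (isolate₃ x y z)) (λ x y z → proj₂ (isolate₃ x y z)) γ∣M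
        module K₁₃ = Kernel n h M κ κ<M u u-injective 0<u fits
          (λ x z y → isSol? (+ α) (+ β) (- + γ) (x , y , z)) β (- + α) (+ γ)
          (λ x z y → proj₁ (isolate₂ x z y)) (λ x z y → proj₂ (isolate₂ x z y)) β∣M
        module K₂₃ = Kernel n h M κ κ<M u u-injective 0<u fits
          (λ y z x → isSol? (+ α) (+ β) (- + γ) (x , y , z)) α (- + β) (+ γ)
          (λ y z x → proj₁ (isolate₁ y z x)) (λ y z x → proj₂ (isolate₁ y z x)) α∣M

        -- On the blocks α x + β y is positive and at most n, so the number of z is constant,
        -- whether dead or alive.
        N₁₂-bounded : Bounded N₁₂ 0ℤ
        N₁₂-bounded = by-cases ((+ γ) ∣? ((+ α + + β) * + κ)) K₁₂.dead⇒Bounded λ alive →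
          K₁₂.Alive.alive⇒Bounded alive
            (λ i s j t → subst (0ℤ <_) (sym (L≡ i s j t)) (+<+ (ℕP.<-≤-trans (0<αX i s) (ℕP.m≤m+n (α ℕ.* X i s) (β ℕ.* X j t)))))
            (λ i s j t → ≤-trans (≤-reflexive (L≡ i s j t)) (+≤+ (α*X+β*X≤n i s j t)))
          where
          L≡ : ∀ i s j t → + α * val (pos i s) + + β * val (pos j t) ≡ + (α ℕ.* X i s ℕ.+ β ℕ.* X j t)
          L≡ i s j t = trans (cong₂ (λ x y → + α * x + + β * y) (val-pos i s) (val-pos j t))
            (sym (cong₂ _+_ (pos-* α (X i s)) (pos-* β (X j t))))
          0<αX : ∀ i s → 0 ℕ.< α ℕ.* X i s
          0<αX i s = ℕP.*-mono-≤ (ℕ.>-nonZero⁻¹ α) (0<X i s)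

        module _ {K p q} .⦃ _ : NonZero p ⦄ .⦃ _ : NonZero q ⦄ (T : Threshold K p q)
          (p≤Σ : p ℕ.≤ Σc) (q≤Σ : q ℕ.≤ Σc) where

          -- When p c i and q c j differ, all four pairs lie on the same side of the threshold, and
          -- the difference of a constant vanishes.
          Δ-far : ∀ i i′ j j′ s t → c i ≡ c i′ → c j ≡ c j′ → p ℕ.* c i ≢ q ℕ.* c j →
            Δ K (pos i s) (pos i′ s) (pos j t) (pos j′ t) ≡ 0ℤ
          Δ-far i i′ j j′ s t ci cj ne = by-order ne less greater
            where
            less : p ℕ.* c i ℕ.< q ℕ.* c j → Δ K (pos i s) (pos i′ s) (pos j t) (pos j′ t) ≡ 0ℤ
            less lt = Δ-below T i i′ j j′ s t
                  (separate p q i j p≤Σ lt)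
                  (separate p q i j′ p≤Σ (subst (λ d → p ℕ.* c i ℕ.< q ℕ.* d) cj lt))
                  (separate p q i′ j p≤Σ lt′)
                  (separate p q i′ j′ p≤Σ (subst (λ d → p ℕ.* c i′ ℕ.< q ℕ.* d) cj lt′))
              where
              lt′ : p ℕ.* c i′ ℕ.< q ℕ.* c j
              lt′ = subst (λ d → p ℕ.* d ℕ.< q ℕ.* c j) ci lt
            greater : q ℕ.* c j ℕ.< p ℕ.* c i → Δ K (pos i s) (pos i′ s) (pos j t) (pos j′ t) ≡ 0ℤ
            greater gt = Δ-above T i i′ j j′ s t
                  (separate q p j i q≤Σ gt)
                  (separate q p j′ i q≤Σ gt′)
                  (separate q p j i′ q≤Σ (subst (λ d → q ℕ.* c j ℕ.< p ℕ.* d) ci gt))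
                  (separate q p j′ i′ q≤Σ (subst (λ d → q ℕ.* c j′ ℕ.< p ℕ.* d) ci gt′))
              where
              gt′ : q ℕ.* c j′ ℕ.< p ℕ.* c i
              gt′ = subst (λ d → q ℕ.* d ℕ.< p ℕ.* c i) cj gt

        -- In units of αγ the values α x start at S + 1 on P⁺ and S + 3 on P⁻, and γ z at S and S +
        -- 2 on Q⁺ and Q⁻. Blocks have width α or γ, at most one unit, so they do not reach the next
        -- offset.
        Δpq-critical : ∀ {K} → Threshold K α γ → ∀ s t → Δpq K s t ≡ -1ℤ
        Δpq-critical T s t = Δ-critical T 0F 1F 2F 3F s t
          (ℕP.≤-trans (ℕP.≤-reflexive (e₁ α γ S)) (ℕP.≤-trans (ℕP.+-monoˡ-≤ _ (ℕP.m≤n*m γ α)) (ℕP.≤-reflexive (e₂ α γ S))))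
          (ℕP.≤-trans (ℕP.≤-reflexive (e₃ α γ S)) (ℕP.≤-trans (ℕP.+-monoˡ-≤ _ (ℕP.m≤m*n α γ)) (ℕP.≤-reflexive (e₄ α γ S))))
          (ℕP.≤-trans (ℕP.≤-reflexive (e₁ α γ S)) (ℕP.≤-trans
            (ℕP.+-mono-≤ (ℕP.m≤n*m γ α) (ℕP.m≤m+n (α ℕ.* γ ℕ.* S) (2 ℕ.* (α ℕ.* γ))))
            (ℕP.≤-reflexive (e₅ α γ S))))
          (ℕP.≤-trans (ℕP.≤-reflexive (e₆ α γ S)) (ℕP.≤-trans (ℕP.+-monoˡ-≤ _ (ℕP.m≤n*m γ α)) (ℕP.≤-reflexive (e₅ α γ S))))
          where
          e₁ : ∀ α γ S → γ ℕ.* (1 ℕ.+ α ℕ.* (S ℕ.+ 0)) ≡ γ ℕ.+ α ℕ.* γ ℕ.* S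
          e₁ = ℕSolver.solve-∀
          e₂ : ∀ α γ S → α ℕ.* γ ℕ.+ α ℕ.* γ ℕ.* S ≡ α ℕ.* (γ ℕ.* (S ℕ.+ 1))
          e₂ = ℕSolver.solve-∀
          e₃ : ∀ α γ S → α ℕ.* (1 ℕ.+ γ ℕ.* (S ℕ.+ 1)) ≡ α ℕ.+ (α ℕ.* γ ℕ.+ α ℕ.* γ ℕ.* S)
          e₃ = ℕSolver.solve-∀
          e₄ : ∀ α γ S → α ℕ.* γ ℕ.+ (α ℕ.* γ ℕ.+ α ℕ.* γ ℕ.* S) ≡ γ ℕ.* (α ℕ.* (S ℕ.+ 2))
          e₄ = ℕSolver.solve-∀
          e₅ : ∀ α γ S → α ℕ.* γ ℕ.+ (α ℕ.* γ ℕ.* S ℕ.+ 2 ℕ.* (α ℕ.* γ)) ≡ α ℕ.* (γ ℕ.* (S ℕ.+ 3))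
          e₅ = ℕSolver.solve-∀
          e₆ : ∀ α γ S → γ ℕ.* (1 ℕ.+ α ℕ.* (S ℕ.+ 2)) ≡ γ ℕ.+ (α ℕ.* γ ℕ.* S ℕ.+ 2 ℕ.* (α ℕ.* γ))
          e₆ = ℕSolver.solve-∀

        -- The threshold compares αγ with γ² on P-P, α² with γα on Q-Q and α² with γ² on Q-P, all
        -- distinct since α ≠ γ. Only P-Q is critical.
        N₁₃-bounded : Bounded N₁₃ -1ℤ
        N₁₃-bounded = record
          { pp≤ = λ s t → ≤-reflexive (cong₂ _+_ (zero-Δ 0F 1F 0F 1F s t refl refl αγ≢γγ)
            (zero-Δ 0F 1F 0F 1F t s refl refl αγ≢γγ))
          ; qq≤ = λ s t → ≤-reflexive (cong₂ _+_ (zero-Δ 2F 3F 2F 3F s t refl refl αα≢γα)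
            (zero-Δ 2F 3F 2F 3F t s refl refl αα≢γα))
          ; pq≤ = λ s t → ≤-reflexive (cong₂ _+_ (Δpq-critical T s t) (zero-Δ 2F 3F 0F 1F s t refl refl αα≢γγ))
          }
          where
          T : Threshold N₁₃ α γ
          T = K₁₃.Alive.alive⇒Threshold alive₂ α γ refl refl γ*X≤n
          zero-Δ = Δ-far T α≤Σ γ≤Σ
          αγ≢γγ : α ℕ.* γ ≢ γ ℕ.* γ
          αγ≢γγ = α≢γ ∘ ℕP.*-cancelʳ-≡ α γ γ
          αα≢γα : α ℕ.* α ≢ γ ℕ.* α
          αα≢γα = α≢γ ∘ ℕP.*-cancelʳ-≡ α γ α
          αα≢γγ : α ℕ.* α ≢ γ ℕ.* γ
          αα≢γγ eq with ℕP.<-cmp α γ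
          ... | tri< lt _ _ = ℕP.<⇒≢ (ℕP.*-mono-< lt lt) eq
          ... | tri≈ _ α≡γ _ = α≢γ α≡γ
          ... | tri> _ _ gt = ℕP.<⇒≢ (ℕP.*-mono-< gt gt) (sym eq)

        -- For the threshold β y < γ z, the P-P and Q-Q comparisons are close only if β = γ, where
        -- `Δ-self` applies. P-Q is close only if α = β, and then contributes -1 as well. Q-P is
        -- close only if βα = γ², which an alive count rules out through `dead₁`.
        N₂₃-bounded : Bounded N₂₃ 0ℤ
        N₂₃-bounded = by-cases ((+ α) ∣? ((- + β + + γ) * + κ)) K₂₃.dead⇒Bounded alive⇒Bounded
          where
          alive⇒Bounded : + α ∣ (- + β + + γ) * + κ → Bounded N₂₃ 0ℤ
          alive⇒Bounded alive = record
            { pp≤ = self 0F 1F refl (ℕP.*-monoʳ-< γ (ℕP.+-monoʳ-< S (s≤s (s≤s z≤n))))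
            ; qq≤ = self 2F 3F refl (ℕP.*-monoʳ-< α (ℕP.+-monoʳ-< S (s≤s z≤n)))
            ; pq≤ = λ s t → +-mono-≤ (cross s t) (≤-reflexive (zero-Δ 2F 3F 0F 1F s t refl refl (λ eq → dead₁ eq alive)))
            }
            where
            T : Threshold N₂₃ β γ
            T = K₂₃.Alive.alive⇒Threshold alive β γ refl refl γ*X≤n
            zero-Δ = Δ-far T β≤Σ γ≤Σ
            self : ∀ i i′ → c i ≡ c i′ → u i ℕ.< u i′ → ∀ s t →
              Δ N₂₃ (pos i s) (pos i′ s) (pos i t) (pos i′ t) + Δ N₂₃ (pos i t) (pos i′ t) (pos i s) (pos i′ s) ≤ 0ℤ
            self i i′ ci lt s t = by-cases (β ℕP.≟ γ)
              (λ β≢γ → ≤-reflexive (cong₂ _+_ (zero-Δ i i′ i i′ s t ci ci (ne β≢γ))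
                (zero-Δ i i′ i i′ t s ci ci (ne β≢γ)))) λ β≡γ →
              Δ-self (subst (λ b → Threshold N₂₃ b γ) β≡γ T) i i′ s t lt
              where
              ne : β ≢ γ → β ℕ.* c i ≢ γ ℕ.* c i
              ne β≢γ = β≢γ ∘ ℕP.*-cancelʳ-≡ β γ (c i) ⦃ c≢0 i ⦄
            cross : ∀ s t → Δpq N₂₃ s t ≤ 0ℤ
            cross s t = by-cases (α ℕP.≟ β) (λ α≢β → ≤-reflexive (zero-Δ 0F 1F 2F 3F s t refl refl
                (λ eq → α≢β (ℕP.*-cancelˡ-≡ α β γ (trans (sym eq) (ℕP.*-comm β γ)))))) λ α≡β →
              ≤-trans (≤-reflexive (Δpq-critical (subst (λ b → Threshold N₂₃ b γ) (sym α≡β) T) s t)) -≤+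

        partial : Σ (Fin n → ℤ) λ g → (∀ x → Trit (g x)) × (QuadraticForm.E (ω (+ α) (+ β) (- + γ)) g ≤ - (+ h * + h))
        partial = dipoles , dipoles-trit , E-dipoles≤ (+ α) (+ β) (- + γ)
          (Bounded-+ (Bounded-+ N₁₂-bounded N₂₃-bounded) N₁₃-bounded)

    generic : NegativelyCorrelated (+ α) (+ β) (- + γ)
    generic = m , λ n h m*h≤n _ _ → partial n h m*h≤n


  module _ (α β γ κ : ℕ) .⦃ _ : NonZero α ⦄ .⦃ _ : NonZero β ⦄ .⦃ _ : NonZero γ ⦄
    (α≢γ : α ≢ γ)
    (alive₂ : + β ∣ (- + α + + γ) * + κ)
    (dead₁ : β ℕ.* α ≡ γ ℕ.* γ → ¬ (+ α ∣ (- + β + + γ) * + κ)) where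

    private
      instance
        αβ≢0 : NonZero (α ℕ.* β)
        αβ≢0 = ℕP.m*n≢0 α β
        αβγ≢0 : NonZero (α ℕ.* β ℕ.* γ)
        αβγ≢0 = ℕP.m*n≢0 (α ℕ.* β) γ

    separated⇒negative : NegativelyCorrelated (+ α) (+ β) (- + γ)
    -- The factor `suc κ` only serves to make M exceed κ while keeping it a multiple of α, β and γ.
    separated⇒negative = Generic.generic α β γ κ (suc κ ℕ.* (α ℕ.* β ℕ.* γ)) (4 ℕ.* ((α ℕ.+ β ℕ.+ γ) ℕ.* (α ℕ.+ γ)))
      (ℕP.m≤m*n (suc κ) (α ℕ.* β ℕ.* γ))
      (∣ᵤ⇒∣ (ℕD.∣n⇒∣m*n (suc κ) (ℕD.∣m⇒∣m*n γ (ℕD.m∣m*n β))))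
      (∣ᵤ⇒∣ (ℕD.∣n⇒∣m*n (suc κ) (ℕD.∣m⇒∣m*n γ (ℕD.n∣m*n α))))
      (∣ᵤ⇒∣ (ℕD.∣n⇒∣m*n (suc κ) (ℕD.n∣m*n (α ℕ.* β))))
      ℕP.≤-refl α≢γ alive₂ dead₁

  -- Equal coefficients, geometric progressions, and all signs

  module Schur where

    -- In units of h, about n/13, the index sums are 2, 5, 8 on P-P, at least 14 on Q-Q, and 8, 11,
    -- 11, 14 on P-Q. A sum of at most 11 forces x + y ≤ n and one of at least 14 forces x + y > n,
    -- so on P-Q only the pair (P⁻, Q⁻) is cut off.
    u : Fin 4 → ℕ
    u 0F = 1
    u 1F = 4
    u 2F = 7
    u 3F = 10

    u-injective : ∀ i j → u i ≡ u j → i ≡ j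
    u-injective = from-yes (Fin.all? λ i → Fin.all? λ j → (u i ℕP.≟ u j) →-dec (i Fin.≟ j))

    0<u : ∀ i → 0 ℕ.< u i
    0<u = from-yes (Fin.all? λ i → 0 ℕP.<? u i)

    u≤10 : ∀ i → u i ℕ.≤ 10
    u≤10 = from-yes (Fin.all? λ i → u i ℕP.≤? 10)

    module _ (n h : ℕ) (13h≤n : 13 ℕ.* h ℕ.≤ n) (n<13[1+h] : n ℕ.< 13 ℕ.* suc h) (13≤h : 13 ℕ.≤ h) where

      fits : ∀ i → 1 ℕ.* h ℕ.* suc (u i) ℕ.≤ n
      fits i = begin
        1 ℕ.* h ℕ.* suc (u i) ≤⟨ ℕP.*-monoʳ-≤ (1 ℕ.* h) (ℕP.≤-trans (s≤s (u≤10 i)) (ℕP.m≤m+n 11 2)) ⟩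
        1 ℕ.* h ℕ.* 13        ≡⟨ e h ⟩
        13 ℕ.* h              ≤⟨ 13h≤n ⟩
        n                     ∎
        where
        open ℕP.≤-Reasoning
        e : ∀ h → 1 ℕ.* h ℕ.* 13 ≡ 13 ℕ.* h
        e = ℕSolver.solve-∀

      open Blocks n h 1 0 (s≤s z≤n) u u-injective 0<u fits
      open QuadraticForm (ω 1ℤ 1ℤ (- 1ℤ) {n}) using (W; N₁₂; N₁₃; N₂₃)
      open Isolate 1ℤ 1ℤ 1ℤ {n}

      module K₁₂ = Kernel n h 1 0 (s≤s z≤n) u u-injective 0<u fits
        (λ x y z → isSol? 1ℤ 1ℤ (- 1ℤ) (x , y , z)) 1 1ℤ 1ℤ
        (λ x y z → proj₁ (isolate₃ x y z)) (λ x y z → proj₂ (isolate₃ x y z)) ∣-refl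
      module K₁₃ = Kernel n h 1 0 (s≤s z≤n) u u-injective 0<u fits
        (λ x z y → isSol? 1ℤ 1ℤ (- 1ℤ) (x , y , z)) 1 (- 1ℤ) 1ℤ
        (λ x z y → proj₁ (isolate₂ x z y)) (λ x z y → proj₂ (isolate₂ x z y)) ∣-refl
      module K₂₃ = Kernel n h 1 0 (s≤s z≤n) u u-injective 0<u fits
        (λ y z x → isSol? 1ℤ 1ℤ (- 1ℤ) (x , y , z)) 1 (- 1ℤ) 1ℤ
        (λ y z x → proj₁ (isolate₁ y z x)) (λ y z x → proj₂ (isolate₁ y z x)) ∣-refl

      sum≡ : ∀ i s j t → 1ℤ * val (pos i s) + 1ℤ * val (pos j t) ≡ + (X i s ℕ.+ X j t)
      sum≡ i s j t = cong₂ _+_ (trans (*-identityˡ (val (pos i s))) (val-pos i s))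
        (trans (*-identityˡ (val (pos j t))) (val-pos j t))

      N₁₂≡1 : ∀ i s j t → u i ℕ.+ u j ℕ.≤ 11 → N₁₂ (pos i s) (pos j t) ≡ 1ℤ
      N₁₂≡1 i s j t le = K₁₂.Alive.alive-one (divides 0ℤ refl) i s j t
        (subst (0ℤ <_) (sym (sum≡ i s j t)) (+<+ (ℕP.<-≤-trans (0<X i s) (ℕP.m≤m+n (X i s) (X j t)))))
        (≤-trans (≤-reflexive (sum≡ i s j t)) (+≤+ (begin
          X i s ℕ.+ X j t ≤⟨ ℕP.+-mono-≤ (ℕP.<⇒≤ (X-upper i s)) (ℕP.<⇒≤ (X-upper j t)) ⟩
          1 ℕ.* h ℕ.* suc (u i) ℕ.+ 1 ℕ.* h ℕ.* suc (u j) ≡⟨ e h (u i) (u j) ⟩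
          (u i ℕ.+ u j ℕ.+ 2) ℕ.* h ≤⟨ ℕP.*-monoˡ-≤ h (ℕP.+-monoˡ-≤ 2 le) ⟩
          13 ℕ.* h ≤⟨ 13h≤n ⟩
          n ∎)))
        where
        open ℕP.≤-Reasoning
        e : ∀ h u v → 1 ℕ.* h ℕ.* (1 ℕ.+ u) ℕ.+ 1 ℕ.* h ℕ.* (1 ℕ.+ v) ≡ (u ℕ.+ v ℕ.+ 2) ℕ.* h
        e = ℕSolver.solve-∀

      N₁₂≡0 : ∀ i s j t → 14 ℕ.≤ u i ℕ.+ u j → N₁₂ (pos i s) (pos j t) ≡ 0ℤ
      N₁₂≡0 i s j t le = K₁₂.Alive.large-zero (divides 0ℤ refl) i s j t
        (subst (+ (1 ℕ.* n) <_) (sym (sum≡ i s j t)) (+<+ (begin-strict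
          1 ℕ.* n ≡⟨ ℕP.*-identityˡ n ⟩
          n <⟨ n<13[1+h] ⟩
          13 ℕ.* suc h ≡⟨ ℕP.*-suc 13 h ⟩
          -- The rounding in h loses less than 13, which one further unit h ≥ 13 absorbs; hence 14
          -- rather than 13 units.
          13 ℕ.+ 13 ℕ.* h ≤⟨ ℕP.+-monoˡ-≤ (13 ℕ.* h) 13≤h ⟩
          14 ℕ.* h ≤⟨ ℕP.*-monoˡ-≤ h le ⟩
          (u i ℕ.+ u j) ℕ.* h ≡⟨ e h (u i) (u j) ⟩
          1 ℕ.* h ℕ.* u i ℕ.+ 1 ℕ.* h ℕ.* u j ≤⟨ ℕP.+-mono-≤ (X-lower i s) (X-lower j t) ⟩
          X i s ℕ.+ X j t ∎)))
        where
        open ℕP.≤-Reasoning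
        e : ∀ h u v → (u ℕ.+ v) ℕ.* h ≡ 1 ℕ.* h ℕ.* u ℕ.+ 1 ℕ.* h ℕ.* v
        e = ℕSolver.solve-∀


      N₁₂-bounded : Bounded N₁₂ -1ℤ
      N₁₂-bounded = record
        { pp≤ = λ s t → ≤-reflexive (cong₂ _+_ (pp s t) (pp t s))
        ; qq≤ = λ s t → ≤-reflexive (cong₂ _+_ (qq s t) (qq t s))
        ; pq≤ = λ s t → ≤-trans (≤-reflexive (cong₂ _+_ (pq s t) (qp s t))) (-≤- z≤n)
        }
        where
        pp : ∀ s t → Δpp N₁₂ s t ≡ 0ℤ
        pp s t = Δ-eval N₁₂ (N₁₂≡1 0F s 0F t (ℕP.m≤m+n 2 9)) (N₁₂≡1 0F s 1F t (ℕP.m≤m+n 5 6))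
                            (N₁₂≡1 1F s 0F t (ℕP.m≤m+n 5 6)) (N₁₂≡1 1F s 1F t (ℕP.m≤m+n 8 3))
        qq : ∀ s t → Δqq N₁₂ s t ≡ 0ℤ
        qq s t = Δ-eval N₁₂ (N₁₂≡0 2F s 2F t (ℕP.m≤m+n 14 0)) (N₁₂≡0 2F s 3F t (ℕP.m≤m+n 14 3))
                            (N₁₂≡0 3F s 2F t (ℕP.m≤m+n 14 3)) (N₁₂≡0 3F s 3F t (ℕP.m≤m+n 14 6))
        pq : ∀ s t → Δpq N₁₂ s t ≡ -1ℤ
        pq s t = Δ-eval N₁₂ (N₁₂≡1 0F s 2F t (ℕP.m≤m+n 8 3)) (N₁₂≡1 0F s 3F t (ℕP.m≤m+n 11 0))
                            (N₁₂≡1 1F s 2F t (ℕP.m≤m+n 11 0)) (N₁₂≡0 1F s 3F t (ℕP.m≤m+n 14 0))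
        qp : ∀ s t → Δqp N₁₂ s t ≡ -1ℤ
        qp s t = Δ-eval N₁₂ (N₁₂≡1 2F s 0F t (ℕP.m≤m+n 8 3)) (N₁₂≡1 2F s 1F t (ℕP.m≤m+n 11 0))
                            (N₁₂≡1 3F s 0F t (ℕP.m≤m+n 11 0)) (N₁₂≡0 3F s 1F t (ℕP.m≤m+n 14 0))

      -- The thresholds x < z and y < z are constant between P and Q because P lies entirely before
      -- Q; within P and within Q the symmetrised bound applies.
      order-bounded : ∀ {K} → Threshold K 1 1 → Bounded K 0ℤ
      order-bounded T = record
        { pp≤ = λ s t → Δ-self T 0F 1F s t (ℕP.m≤m+n 2 2)
        ; qq≤ = λ s t → Δ-self T 2F 3F s t (ℕP.m≤m+n 8 2)
        ; pq≤ = λ s t → ≤-reflexive (cong₂ _+_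
            (Δ-below T 0F 1F 2F 3F s t (ℕP.m≤m+n 2 5) (ℕP.m≤m+n 2 8) (ℕP.m≤m+n 5 2) (ℕP.m≤m+n 5 5))
            (Δ-above T 2F 3F 0F 1F s t (ℕP.m≤m+n 2 5) (ℕP.m≤m+n 5 2) (ℕP.m≤m+n 2 8) (ℕP.m≤m+n 5 5)))
        }

      1*X≤n : ∀ i t → 1 ℕ.* X i t ℕ.≤ n
      1*X≤n i t = ℕP.≤-trans (ℕP.≤-reflexive (ℕP.*-identityˡ (X i t))) (X≤n i t)

      partial : Σ (Fin n → ℤ) λ g → (∀ x → Trit (g x)) × (QuadraticForm.E (ω 1ℤ 1ℤ (- 1ℤ)) g ≤ - (+ h * + h))
      partial = dipoles , dipoles-trit , E-dipoles≤ 1ℤ 1ℤ (- 1ℤ)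
        (Bounded-+ (Bounded-+ N₁₂-bounded
          (order-bounded (K₂₃.Alive.alive⇒Threshold (divides 0ℤ refl) 1 1 refl refl 1*X≤n)))
          (order-bounded (K₁₃.Alive.alive⇒Threshold (divides 0ℤ refl) 1 1 refl refl 1*X≤n)))

  schur : NegativelyCorrelated 1ℤ 1ℤ (- 1ℤ)
  schur = 12 , Schur.partial

  schur-scaled : ∀ α → .⦃ _ : NonZero α ⦄ → NegativelyCorrelated (+ α) (+ α) (- + α)
  schur-scaled α = transfer {+ α} {+ α} {(- + α)} {1ℤ} {1ℤ} {(- 1ℤ)}
    (λ g → ∑³-cong λ x y z → cong (_* pairs (g x) (g y) (g z))
      (𝟙-⇔ (isSol? (+ α) (+ α) (- + α) (x , y , z)) (isSol? 1ℤ 1ℤ (- 1ℤ) (x , y , z))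
        (λ eq → *-cancelˡ-≡ (+ α) (1ℤ * val x + 1ℤ * val y + (- 1ℤ) * val z) 0ℤ
          ⦃ ≢-nonZero (ℕ.≢-nonZero⁻¹ α ∘ +-injective) ⦄
          (trans (sym (factor (+ α) (val x) (val y) (val z))) (trans eq (sym (*-zeroʳ (+ α))))))
        (λ eq → trans (factor (+ α) (val x) (val y) (val z)) (trans (cong (+ α *_) eq) (*-zeroʳ (+ α))))))
    schur
    where
    factor : ∀ a x y z → a * x + a * y + - a * z ≡ a * (1ℤ * x + 1ℤ * y + - 1ℤ * z)
    factor = solve-∀

  -- With β = g b and γ = g c for g = gcd(β, γ), the residue b² works: β ∣ (γ - α) b² keeps the threshold αx < γz,
  -- while α ∣ (γ - β) b² would force c ∣ b⁴, hence c = 1 by coprimality.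
  module Geometric (α β γ : ℕ) .⦃ _ : NonZero α ⦄ .⦃ _ : NonZero β ⦄ .⦃ _ : NonZero γ ⦄
    (γ<α : γ ℕ.< α) (βα≡γ² : β ℕ.* α ≡ γ ℕ.* γ) where

    private
      g b c κ : ℕ
      instance
        g≢0 : NonZero (gcd β γ)
        g≢0 = ℕ.≢-nonZero (gcd[m,n]≢0 β γ (inj₁ (ℕ.≢-nonZero⁻¹ β)))
      g = gcd β γ
      b = β ℕ./ g
      c = γ ℕ./ g
      κ = b ℕ.* b

      β≡gb : + β ≡ + g * + b
      β≡gb = trans (cong +_ (sym (ℕ.m*[n/m]≡n (gcd[m,n]∣m β γ)))) (pos-* g b)

      γ≡gc : + γ ≡ + g * + c
      γ≡gc = trans (cong +_ (sym (ℕ.m*[n/m]≡n (gcd[m,n]∣n β γ)))) (pos-* g c)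

      κ≡b² : + κ ≡ + b * + b
      κ≡b² = pos-* b b

      βα≡γ²′ : + β * + α ≡ + γ * + γ
      βα≡γ²′ = trans (sym (pos-* β α)) (trans (cong +_ βα≡γ²) (pos-* γ γ))

      instance
        +g≢0 : ℤ.NonZero (+ g)
        +g≢0 = ≢-nonZero (ℕ.≢-nonZero⁻¹ g ∘ +-injective)
        g²≢0 : ℤ.NonZero (+ g * + g)
        g²≢0 = i*j≢0 (+ g) (+ g)

      β<γ : β ℕ.< γ
      β<γ = ℕP.≰⇒> λ γ≤β → ℕP.<⇒≢ (ℕP.≤-<-trans (ℕP.*-monoˡ-≤ γ γ≤β) (ℕP.*-monoʳ-< β γ<α)) (sym βα≡γ²)

      alive : + β ∣ (- + α + + γ) * + κ
      -- From g b α = γ² = g² c² one gets α b² = c² β, and γ b² = c b β; the quotient is their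
      -- difference c b - c².
      alive = divides (- (+ c * + c) + + c * + b) (*-cancelˡ-≡ (+ g) _ _ (begin
        + g * ((- + α + + γ) * + κ) ≡⟨ cong₂ (λ x k → + g * ((- + α + x) * k)) γ≡gc κ≡b² ⟩
        + g * ((- + α + + g * + c) * (+ b * + b)) ≡⟨ e₁ (+ α) (+ g) (+ b) (+ c) ⟩
        - (+ g * + b * + α) * + b + + g * (+ g * + c) * (+ b * + b)
          ≡⟨ cong (λ x → - x * + b + + g * (+ g * + c) * (+ b * + b)) gbα ⟩
        - (+ g * + c * (+ g * + c)) * + b + + g * (+ g * + c) * (+ b * + b) ≡⟨ e₂ (+ g) (+ b) (+ c) ⟩
        + g * ((- (+ c * + c) + + c * + b) * (+ g * + b))
          ≡⟨ cong (λ x → + g * ((- (+ c * + c) + + c * + b) * x)) β≡gb ⟨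
        + g * ((- (+ c * + c) + + c * + b) * + β) ∎))
        where
        open ≡-Reasoning
        gbα : + g * + b * + α ≡ + g * + c * (+ g * + c)
        gbα = trans (cong (_* + α) (sym β≡gb)) (trans βα≡γ²′ (cong₂ _*_ γ≡gc γ≡gc))
        e₁ : ∀ α g b c → g * ((- α + g * c) * (b * b)) ≡ - (g * b * α) * b + g * (g * c) * (b * b)
        e₁ = solve-∀
        e₂ : ∀ g b c → - (g * c * (g * c)) * b + g * (g * c) * (b * b) ≡ g * ((- (c * c) + c * b) * (g * b))
        e₂ = solve-∀

      c∤b⁴ : ¬ (+ c ∣ + (b ℕ.* (b ℕ.* (b ℕ.* b))))
      -- Coprimality strips the factors b one at a time until c = 1, against 0 < b < c, which comes
      -- from β < γ.
      c∤b⁴ c∣b⁴ = ℕP.<⇒≱ b<c (subst (ℕ._≤ b) (sym c≡1) 0<b)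
        where
        coprime : Coprimality.Coprime c b
        coprime = Coprimality.sym (Coprimality.coprime-/gcd β γ)
        c≡1 : c ≡ 1
        c≡1 = ℕD.∣1⇒≡1 (Coprimality.coprime-divisor coprime (subst (c ℕD.∣_) (sym (ℕP.*-identityʳ b))
          (Coprimality.coprime-divisor coprime
            (Coprimality.coprime-divisor coprime (Coprimality.coprime-divisor coprime (∣⇒∣ᵤ c∣b⁴))))))
        gb<gc : g ℕ.* b ℕ.< g ℕ.* c
        gb<gc = subst₂ ℕ._<_ (sym (ℕ.m*[n/m]≡n (gcd[m,n]∣m β γ))) (sym (ℕ.m*[n/m]≡n (gcd[m,n]∣n β γ))) β<γ
        b<c : b ℕ.< c
        b<c = ℕP.*-cancelˡ-< g b c gb<gc
        0<b : 0 ℕ.< b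
        0<b = ℕP.n≢0⇒n>0 λ b≡0 → ℕ.≢-nonZero⁻¹ β (trans (sym (ℕ.m*[n/m]≡n (gcd[m,n]∣m β γ)))
          (trans (cong (g ℕ.*_) b≡0) (ℕP.*-zeroʳ g)))

      -- Multiplying by β turns the divisor βα into γ² = g²c² and the dividend into g² b³(c - b).
      -- Cancelling g² gives c ∣ b³(c - b), hence c ∣ b⁴.
      dead : ¬ (+ α ∣ (- + β + + γ) * + κ)
      dead α∣ = c∤b⁴ (subst (+ c ∣_) (sym b⁴) (∣m+n∣m⇒∣n {m = - (+ c * (+ b * (+ b * + b)))} (subst (+ c ∣_) e₃ c∣bκ)
          (∣m⇒∣-m (∣m⇒∣m*n (+ b * (+ b * + b)) ∣-refl))))
        where
        b⁴ : + (b ℕ.* (b ℕ.* (b ℕ.* b))) ≡ + b * (+ b * (+ b * + b))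
        b⁴ = trans (pos-* b _) (cong (+ b *_) (trans (pos-* b _) (cong (+ b *_) (pos-* b b))))
        X : ℤ
        X = + b * (+ b * + b) * (- + b + + c)
        γ²∣ : + g * + g * (+ c * + c) ∣ + g * + g * X
        γ²∣ = subst₂ _∣_ lhs rhs (*-monoʳ-∣ (+ β) α∣)
          where
          open ≡-Reasoning
          e : ∀ g c → g * c * (g * c) ≡ g * g * (c * c)
          e = solve-∀
          e′ : ∀ g b c → g * b * ((- (g * b) + g * c) * (b * b)) ≡ g * g * (b * (b * b) * (- b + c))
          e′ = solve-∀
          lhs : + β * + α ≡ + g * + g * (+ c * + c)
          lhs = trans βα≡γ²′ (trans (cong₂ _*_ γ≡gc γ≡gc) (e (+ g) (+ c)))
          rhs : + β * ((- + β + + γ) * + κ) ≡ + g * + g * X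
          rhs = trans (cong₂ _*_ β≡gb (cong₂ _*_ (cong₂ (λ x y → - x + y) β≡gb γ≡gc) κ≡b²)) (e′ (+ g) (+ b) (+ c))
        c∣bκ : + c ∣ - X
        c∣bκ = ∣m⇒∣-m (∣-trans (∣m⇒∣m*n (+ c) ∣-refl) (*-cancelˡ-∣ (+ g * + g) γ²∣))
        e₃ : - X ≡ - (+ c * (+ b * (+ b * + b))) + + b * (+ b * (+ b * + b))
        e₃ = e (+ b) (+ c)
          where
          e : ∀ b c → - (b * (b * b) * (- b + c)) ≡ - (c * (b * (b * b))) + b * (b * (b * b))
          e = solve-∀

    geometric : NegativelyCorrelated (+ α) (+ β) (- + γ)
    geometric = separated⇒negative α β γ κ (ℕP.<⇒≢ γ<α ∘ sym) alive (λ _ → dead)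

  -- If βα ≠ γ², then α and β are not both equal to γ, and exchanging x and y arranges α ≠ γ. If βα
  -- = γ², then α > γ, or β > γ, or all three coefficients agree.
  positive-coefficients : ∀ α β γ → .⦃ _ : NonZero α ⦄ .⦃ _ : NonZero β ⦄ .⦃ _ : NonZero γ ⦄ →
    NegativelyCorrelated (+ α) (+ β) (- + γ)
  positive-coefficients α β γ with β ℕ.* α ℕP.≟ γ ℕ.* γ
  ... | no βα≢γ² = non-geometric (α ℕP.≟ γ) (β ℕP.≟ γ)
    where
    ∣0 : ∀ k m → k ∣ m * 0ℤ
    ∣0 k m = divides 0ℤ (*-zeroʳ m)
    non-geometric : Dec (α ≡ γ) → Dec (β ≡ γ) → NegativelyCorrelated (+ α) (+ β) (- + γ)
    -- The residue κ = 0 makes every divisibility condition hold, and `dead₁` is vacuous.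
    non-geometric (no α≢γ) _ = separated⇒negative α β γ 0 α≢γ (∣0 (+ β) (- + α + + γ)) (⊥-elim ∘ βα≢γ²)
    non-geometric (yes _) (no β≢γ) = swap₁₂ {+ α} {+ β} {(- + γ)}
      (separated⇒negative β α γ 0 β≢γ (∣0 (+ α) (- + β + + γ)) (⊥-elim ∘ βα≢γ² ∘ trans (ℕP.*-comm β α)))
    non-geometric (yes α≡γ) (yes β≡γ) = ⊥-elim (βα≢γ² (cong₂ ℕ._*_ β≡γ α≡γ))
  ... | yes βα≡γ² with ℕP.<-cmp α γ
  ...   | tri> _ _ γ<α = Geometric.geometric α β γ γ<α βα≡γ²
  ...   | tri< α<γ _ _ = swap₁₂ {+ α} {+ β} {(- + γ)}
    (Geometric.geometric β α γ γ<β (trans (ℕP.*-comm α β) βα≡γ²))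
    where
    γ<β : γ ℕ.< β
    γ<β = ℕP.≰⇒> λ β≤γ → ℕP.<⇒≢ (ℕP.≤-<-trans (ℕP.*-monoˡ-≤ α β≤γ) (ℕP.*-monoʳ-< γ α<γ)) βα≡γ²
  ...   | tri≈ _ refl _ = subst (λ b → NegativelyCorrelated (+ α) (+ b) (- + α))
    (sym (ℕP.*-cancelʳ-≡ β α α βα≡γ²)) (schur-scaled α)

  -- Permuting the variables and changing the overall sign brings each of the six mixed patterns to
  -- two positive coefficients followed by a negative one.
  mixed-signs : ∀ a b c → a ≢ 0ℤ → b ≢ 0ℤ → c ≢ 0ℤ →
    ¬ ((0ℤ < a) × (0ℤ < b) × (0ℤ < c)) → ¬ ((a < 0ℤ) × (b < 0ℤ) × (c < 0ℤ)) → NegativelyCorrelated a b c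
  mixed-signs (+ zero) b c a≢0 _ _ _ _ = ⊥-elim (a≢0 refl)
  mixed-signs a (+ zero) c _ b≢0 _ _ _ = ⊥-elim (b≢0 refl)
  mixed-signs a b (+ zero) _ _ c≢0 _ _ = ⊥-elim (c≢0 refl)
  mixed-signs +[1+ a ] +[1+ b ] +[1+ c ] _ _ _ ¬+ _ = ⊥-elim (¬+ (+<+ (s≤s z≤n) , +<+ (s≤s z≤n) , +<+ (s≤s z≤n)))
  mixed-signs -[1+ a ] -[1+ b ] -[1+ c ] _ _ _ _ ¬- = ⊥-elim (¬- (-<+ , -<+ , -<+))
  mixed-signs +[1+ a ] +[1+ b ] -[1+ c ] _ _ _ _ _ = positive-coefficients (suc a) (suc b) (suc c)
  mixed-signs +[1+ a ] -[1+ b ] +[1+ c ] _ _ _ _ _ = swap₂₃ {+[1+ a ]} { -[1+ b ]} {+[1+ c ]}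
    (positive-coefficients (suc a) (suc c) (suc b))
  mixed-signs -[1+ a ] +[1+ b ] +[1+ c ] _ _ _ _ _ = swap₁₂ { -[1+ a ]} {+[1+ b ]} {+[1+ c ]}
    (swap₂₃ {+[1+ b ]} { -[1+ a ]} {+[1+ c ]} (positive-coefficients (suc b) (suc c) (suc a)))
  mixed-signs -[1+ a ] -[1+ b ] +[1+ c ] _ _ _ _ _ = negate { -[1+ a ]} { -[1+ b ]} {+[1+ c ]}
    (positive-coefficients (suc a) (suc b) (suc c))
  mixed-signs -[1+ a ] +[1+ b ] -[1+ c ] _ _ _ _ _ = negate { -[1+ a ]} {+[1+ b ]} { -[1+ c ]}
    (swap₂₃ {+[1+ a ]} { -[1+ b ]} {+[1+ c ]} (positive-coefficients (suc a) (suc c) (suc b)))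
  mixed-signs +[1+ a ] -[1+ b ] -[1+ c ] _ _ _ _ _ = negate {+[1+ a ]} { -[1+ b ]} { -[1+ c ]}
    (swap₁₂ { -[1+ a ]} {+[1+ b ]} {+[1+ c ]}
      (swap₂₃ {+[1+ b ]} { -[1+ a ]} {+[1+ c ]} (positive-coefficients (suc b) (suc c) (suc a))))

open import Data.Nat using (_≤_; _<_; _*_)

theorem2p1 : (a b c : ℤ) → a ≢ 0ℤ → b ≢ 0ℤ → c ≢ 0ℤ →
    ¬ ((0ℤ ℤ.< a) × (0ℤ ℤ.< b) × (0ℤ ℤ.< c)) →
    ¬ ((a ℤ.< 0ℤ) × (b ℤ.< 0ℤ) × (c ℤ.< 0ℤ)) →
    Σ ℕ (λ p → Σ ℕ (λ q → (4 * p < q) × Σ ℕ (λ N → (n : ℕ) → N ≤ n →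
    Σ (Coloring n) (λ f → q * monoCount a b c n f ≤ p * solCount a b c n))))
theorem2p1 a b c a≢0 b≢0 c≢0 ¬positive ¬negative =
  Correlation.uncommon a b c a≢0 b≢0 c≢0
    (Correlation.mixed-signs a b c a≢0 b≢0 c≢0 ¬positive ¬negative)
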